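{- For every fixed $k\in\mathbb{N}$ there exists a constant $C=C(k)$ such that the following holds. Let $V$ be a set of $n$ vertices and suppose $M_1,\dots,M_k$ are perfect matchings on $V$ such that $$\Big|M_i\setminus \bigcup_{j\neq i}M_j\Big|\ge C$$ for each $i\in[k]$. Then there exists a perfect matching $M^*$ on $V$ such that $M^*\cup M_i$ forms a Hamilton cycle on $V$ for each $i\in[k]$.
   Context: A perfect matching on a finite set $V$ is a set of pairwise vertex-disjoint edges of the complete graph on $V$ covering all of $V$ (so $n=|V|$ is even). The matchings $M_1,\dots,M_k$ are not required to be edge-disjoint. $[k]=\{1,\dots,k\}$. -}

module Defs where

open import Data.Bool using (Bool; false; _∧_; _∨_; not; T)
open import Data.Bool.Properties using (T?)
open import Data.Fin using (Fin; toℕ; _≟_; _<?_)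
open import Data.Fin.Permutation using (Permutation′; _⟨$⟩ʳ_)
open import Data.List using (List; allFin; cartesianProduct; filter; foldr; length; map)
open import Data.Nat using (ℕ; suc; _≤_)
open import Data.Nat.DivMod using (_mod_)
open import Data.Product using (_×_; _,_; ∃-syntax)
open import Data.Sum using (_⊎_)
open import Function using (_⇔_)
open import Relation.Binary.PropositionalEquality using (_≡_; refl; cong; cong₂)
open import Relation.Nullary using (¬?; _×-dec_)

-- A set of edges of the complete graph on Fin n, given by its (symmetric,
-- irreflexive) Boolean adjacency relation: the unordered pair {u , v} belongs
-- to the set exactly when `adj u v` is true.
record EdgeSet (n : ℕ) : Set where
  field
    adj    : Fin n → Fin n → Bool
    sym    : ∀ u v → adj u v ≡ adj v u
    irrefl : ∀ u → adj u u ≡ false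

open EdgeSet public using (adj)

private
  variable
    n k : ℕ

infix 4 [_,_]∈_

[_,_]∈_ : Fin n → Fin n → EdgeSet n → Set
[ u , v ]∈ E = T (adj E u v)

infixr 6 _∪_
infixl 7 _∖_

_∪_ : EdgeSet n → EdgeSet n → EdgeSet n
E ∪ F = record
  { adj    = λ u v → adj E u v ∨ adj F u v
  ; sym    = λ u v → cong₂ _∨_ (EdgeSet.sym E u v) (EdgeSet.sym F u v)
  ; irrefl = λ u → cong₂ _∨_ (EdgeSet.irrefl E u) (EdgeSet.irrefl F u)
  }

_∖_ : EdgeSet n → EdgeSet n → EdgeSet n
E ∖ F = record
  { adj    = λ u v → adj E u v ∧ not (adj F u v)
  ; sym    = λ u v → cong₂ (λ a b → a ∧ not b) (EdgeSet.sym E u v) (EdgeSet.sym F u v)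
  ; irrefl = λ u → cong (_∧ not (adj F u u)) (EdgeSet.irrefl E u)
  }

∅ : EdgeSet n
∅ = record { adj = λ _ _ → false ; sym = λ _ _ → refl ; irrefl = λ _ → refl }

⋃ : List (EdgeSet n) → EdgeSet n
⋃ = foldr _∪_ ∅

-- The union of all M j with j ≢ i.
⋃≢ : Fin k → (Fin k → EdgeSet n) → EdgeSet n
⋃≢ {k = k} i M = ⋃ (map M (filter (λ j → ¬? (j ≟ i)) (allFin k)))

-- Each unordered pair is counted once, as the ordered pair with u < v.
∣_∣ : EdgeSet n → ℕ
∣_∣ {n} E =
  length (filter (λ (u , v) → (u <? v) ×-dec T? (adj E u v))
                 (cartesianProduct (allFin n) (allFin n)))

record IsPerfectMatching {n : ℕ} (M : EdgeSet n) : Set where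
  field
    -- Two edges of M with a common endpoint u coincide.
    disjoint : ∀ u v w → [ u , v ]∈ M → [ u , w ]∈ M → v ≡ w
    covering : ∀ u → ∃[ v ] [ u , v ]∈ M

-- Successor modulo n.
next : Fin n → Fin n
next {suc m} i = suc (toℕ i) mod suc m

-- E is exactly the edge set of a cycle σ 0, σ 1, …, σ (n - 1), σ 0 through
-- every vertex.  The bound on n rules out the degenerate "cycles" on at most
-- two vertices.
record IsHamiltonCycle {n : ℕ} (E : EdgeSet n) : Set where
  field
    3≤n   : 3 ≤ n
    σ     : Permutation′ n
    edges : ∀ u v → [ u , v ]∈ E ⇔
              (∃[ i ] ((u ≡ σ ⟨$⟩ʳ i × v ≡ σ ⟨$⟩ʳ next i) ⊎
                       (v ≡ σ ⟨$⟩ʳ i × u ≡ σ ⟨$⟩ʳ next i)))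

{-# OPTIONS --safe #-}
module Submission where

-- View the matchings as fixed-point-free involutions m l.  Matching two free
-- vertices u, v of V contracts each m l to a matching e l of the remaining free
-- vertices, so an M* making m l ∪ M* connected can be built by contracting edges uv
-- with e l u ≢ v for all l, until about k free vertices are left; matching
-- these arbitrarily gives at most k + 1 cycles in every colour.  To repair this,
-- k gadgets per colour i are made beforehand: edges xy of M* such that xy lies
-- on a cycle of its own in every colour l ≢ i, but on a path in colour i.  Private edges
-- of the colours j ≢ i are what allows to steer the path from x in colour j to y
-- without affecting the other colours.  Afterwards replace xy and an edge r r′
-- by one of the two other matchings of {x, y, r, r′}: for l ≢ i both
-- choices merge two cycles, and for i at least one of them does not split a cycle,
-- and merges two cycles if x and r were on different ones.  Hence each gadget of
-- colour i lowers the number of cycles in colour i alone.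

open import Defs
open import Data.Bool using (T; not; false)
open import Data.Bool.Properties using (T?; T-∧; T-∨)
open import Data.Empty using (⊥-elim)
open import Data.Fin as Fin using (Fin; zero; suc; toℕ; fromℕ<; opposite; _≟_; _<?_)
open import Data.Fin.Permutation using (Permutation′; permutation; _⟨$⟩ʳ_)
open import Data.Fin.Properties
  using (all?; any?; injective⇒≤; opposite-involutive; opposite-prop; pigeonhole;
         toℕ-fromℕ<; toℕ-injective; toℕ<n)
open import Data.List
  using (List; []; _∷_; _++_; allFin; cartesianProduct; filter; length; lookup; tabulate)
import Data.List.Membership.DecPropositional as DecMembership
open import Data.List.Membership.Propositional using (_∈_; _∉_; find; lose)
open import Data.List.Membership.Propositional.Properties
  using (∈-++⁺ˡ; ∈-++⁺ʳ; ∈-allFin; ∈-filter⁺; ∈-filter⁻; ∈-lookup; ∈-map⁺; ∈-tabulate⁺)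
open import Data.List.Properties using (filter-++; length-++; length-filter; length-tabulate)
open import Data.List.Relation.Unary.All as All using ([]; _∷_)
open import Data.List.Relation.Unary.AllPairs using ([]; _∷_)
open import Data.List.Relation.Unary.Any as Any using (here; there)
open import Data.List.Relation.Unary.Any.Properties using (lookup-index)
open import Data.List.Relation.Unary.Unique.Propositional using (Unique)
import Data.List.Relation.Unary.Unique.Propositional.Properties as Unique
open import Data.Nat using (ℕ; zero; suc; pred; _+_; _*_; _∸_; _≤_; _<_; z≤n; s≤s)
open import Data.Nat.DivMod
  using (_/_; _%_; _mod_; m%n<n; m<n⇒m%n≡m; m≡m%n+[m/n]*n; n%n≡0)
open import Data.Nat.Divisibility using (_∣_; divides)
open import Data.Nat.Properties
  using (*-comm; +-assoc; +-comm; +-identityʳ; +-mono-≤; +-monoʳ-≤; +-monoˡ-≤; +-suc;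
         <-asym; <-cmp; <⇒≱; even≢odd; m∸n+n≡m; m≤m+n; m≤n+m; m≤n⇒m<n∨m≡n; m≤n⇒m∸n≡0;
         pred[m∸n]≡m∸[1+n]; ≤-antisym; ≤-pred; ≤-refl; ≤-reflexive; ≤-trans)
open import Data.Product using (_×_; _,_; ∃-syntax; proj₁; proj₂)
open import Data.Sum using (_⊎_; inj₁; inj₂; [_,_]′)
open import Function using (_∘_; id; _⇔_; mk⇔; Equivalence)
open import Relation.Binary using (tri<; tri≈; tri>)
open import Relation.Binary.Construct.Closure.ReflexiveTransitive
  using (Star; ε; _◅_; _◅◅_; reverse)
open import Relation.Binary.PropositionalEquality
  using (_≡_; _≢_; refl; sym; trans; cong; cong₂; subst; ≢-sym; module ≡-Reasoning)
open import Relation.Nullary using (¬_; ¬?; Dec; does; yes; no; _×-dec_)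
open import Relation.Nullary.Decidable using (dec-false; does-⇔)

open Equivalence using (to; from)

-- Fixed-point-free involutions, alternating paths and extension of partial matchings.

record IsPairing {n : ℕ} (f : Fin n → Fin n) : Set where
  field
    involutive : ∀ x → f (f x) ≡ x
    fixedPointFree : ∀ x → f x ≢ x

open IsPairing

flip-≡ : ∀ {n} {f : Fin n → Fin n} → (∀ x → f (f x) ≡ x) → ∀ {x y} → f x ≡ y → f y ≡ x
flip-≡ inv {x} refl = inv x

pairing-flip : ∀ {n} {f : Fin n → Fin n} → IsPairing f → ∀ {x y} → f x ≡ y → f y ≡ x
pairing-flip pf = flip-≡ (involutive pf)

Step : ∀ {n} → (f g : Fin n → Fin n) → Fin n → Fin n → Set
Step f g x y = (f x ≡ y) ⊎ (g x ≡ y)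

Path : ∀ {n} → (f g : Fin n → Fin n) → Fin n → Fin n → Set
Path f g = Star (Step f g)

module _ {n : ℕ} {f : Fin n → Fin n} where

  stepˡ : ∀ {g} x → Path f g x (f x)
  stepˡ x = inj₁ refl ◅ ε

  stepʳ : ∀ {g} x → Path f g x (g x)
  stepʳ x = inj₂ refl ◅ ε

  path-sym : ∀ {g} → (∀ x → f (f x) ≡ x) → (∀ x → g (g x) ≡ x) →
             ∀ {x y} → Path f g x y → Path f g y x
  path-sym f-inv g-inv =
    reverse [ inj₁ ∘ flip-≡ f-inv , inj₂ ∘ flip-≡ g-inv ]′

  path-reroute : ∀ {g h} → (∀ x → Path f h x (g x)) →
                 ∀ {x y} → Path f g x y → Path f h x y
  path-reroute r ε = ε
  path-reroute r (inj₁ e ◅ p) = inj₁ e ◅ path-reroute r p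
  path-reroute r (inj₂ refl ◅ p) = r _ ◅◅ path-reroute r p

infix 4 _≼_

-- A vertex fixed by s counts as unmatched, so s ≼ t says that t extends s.
_≼_ : ∀ {n} → (s t : Fin n → Fin n) → Set
s ≼ t = ∀ x → s x ≡ x ⊎ t x ≡ s x

≼-trans : ∀ {n} {s t u : Fin n → Fin n} → s ≼ t → t ≼ u → s ≼ u
≼-trans p q x with p x
... | inj₁ e = inj₁ e
... | inj₂ e with q x
...   | inj₁ e′ = inj₁ (trans (sym e) e′)
...   | inj₂ e′ = inj₂ (trans e′ e)

≼-fixed : ∀ {n} {s t : Fin n → Fin n} → s ≼ t → ∀ {x} → t x ≡ x → s x ≡ x
≼-fixed p {x} e = [ id , (λ e′ → trans (sym e′) e) ]′ (p x)

≼-path : ∀ {n} {f s t : Fin n → Fin n} → s ≼ t → ∀ {x y} → Path f s x y → Path f t x y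
≼-path {f = f} {s} {t} p = path-reroute λ x →
  [ (λ e → subst (Path f t x) (sym e) ε) , (λ e → subst (Path f t x) e (stepʳ x)) ]′ (p x)

-- Local changes of maps and pairings.

data Position {n : ℕ} (a b x : Fin n) : Set where
  at₁  : x ≡ a → Position a b x
  at₂  : x ≢ a → x ≡ b → Position a b x
  away : x ≢ a → x ≢ b → Position a b x

position : ∀ {n} (a b x : Fin n) → Position a b x
position a b x with x ≟ a | x ≟ b
... | yes p | _     = at₁ p
... | no p  | yes q = at₂ p q
... | no p  | no q  = away p q

override : ∀ {n} {A : Set} {a b x : Fin n} → Position a b x → A → A → A → A
override (at₁ _)    p q r = p
override (at₂ _ _)  p q r = q
override (away _ _) p q r = r

module Override {n : ℕ} (a b : Fin n) (p q : Fin n) (g : Fin n → Fin n) where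

  ov : Fin n → Fin n
  ov x = override (position a b x) p q (g x)

  ov₁ : ∀ {x} → x ≡ a → ov x ≡ p
  ov₁ {x} e with position a b x
  ... | at₁ _    = refl
  ... | at₂ ¬e _ = ⊥-elim (¬e e)
  ... | away ¬e _ = ⊥-elim (¬e e)

  ov₂ : ∀ {x} → x ≢ a → x ≡ b → ov x ≡ q
  ov₂ {x} ¬e e with position a b x
  ... | at₁ e′   = ⊥-elim (¬e e′)
  ... | at₂ _ _  = refl
  ... | away _ ¬e′ = ⊥-elim (¬e′ e)

  ov₃ : ∀ {x} → x ≢ a → x ≢ b → ov x ≡ g x
  ov₃ {x} ¬e ¬e′ with position a b x
  ... | at₁ e   = ⊥-elim (¬e e)
  ... | at₂ _ e = ⊥-elim (¬e′ e)
  ... | away _ _ = refl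

-- Conjugating `t` by the transposition of `t a` and `c` turns the edges from `a` to `t a` and from
-- `c` to `t c` into edges from `a` to `c` and from `t a` to `t c`. A conjugate of a pairing is
-- again a pairing.
module Rewire {n : ℕ} {t : Fin n → Fin n} (pt : IsPairing t) {a c : Fin n} (c≢a : c ≢ a) (c≢ta : c ≢ t a) where

  private
    module Swap = Override (t a) c c (t a) id

    swap : Fin n → Fin n
    swap = Swap.ov

    swap-inv : ∀ x → swap (swap x) ≡ x
    swap-inv x with position (t a) c x
    ... | at₁ refl   = Swap.ov₂ c≢ta refl
    ... | at₂ _ refl = Swap.ov₁ refl
    ... | away p q   = Swap.ov₃ p q

  t′ : Fin n → Fin n
  t′ x = swap (t (swap x))

  pairing : IsPairing t′
  pairing = record
    { involutive = λ x → trans (cong (swap ∘ t) (swap-inv (t (swap x))))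
                        (trans (cong swap (involutive pt (swap x))) (swap-inv x))
    ; fixedPointFree = λ x q → fixedPointFree pt (swap x) (trans (sym (swap-inv (t (swap x)))) (cong swap q)) }

  a↦ : t′ a ≡ c
  a↦ = trans (cong (swap ∘ t) (Swap.ov₃ (≢-sym (fixedPointFree pt a)) (≢-sym c≢a))) (Swap.ov₁ refl)

  ta↦ : t′ (t a) ≡ t c
  ta↦ = trans (cong (swap ∘ t) (Swap.ov₁ refl))
    (Swap.ov₃ (λ q → c≢a (trans (sym (involutive pt c)) (trans (cong t q) (involutive pt a))))
              (fixedPointFree pt c))

  off : ∀ {x} → x ≢ a → x ≢ t a → x ≢ c → x ≢ t c → t′ x ≡ t x
  off {x} x≢a x≢ta x≢c x≢tc = trans (cong (swap ∘ t) (Swap.ov₃ x≢ta x≢c))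
    (Swap.ov₃ (λ q → x≢a (trans (sym (involutive pt x)) (trans (cong t q) (involutive pt a))))
              (λ q → x≢tc (sym (pairing-flip pt q))))

-- Later `L` lists representatives of cycles; `r₀` is to stay and `r₁` to be merged into it. If `L`
-- has a single element, then `r₁` is `r₀` itself and nothing is dropped, hence the first
-- alternative of `smaller`.
record Shrunk {A : Set} (L : List A) (r₀ : A) : Set where
  field
    r₁      : A
    R       : List A
    r₁∈     : r₁ ∈ L
    R⊆      : ∀ {w} → w ∈ R → w ∈ L
    r₀∈     : r₀ ∈ R
    rest    : ∀ {w} → w ∈ L → w ∈ R ⊎ w ≡ r₁
    smaller : length R ≤ 1 ⊎ suc (length R) ≤ length L

shrink : ∀ {A : Set} {L : List A} {r₀ : A} → r₀ ∈ L → Shrunk L r₀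
shrink {L = a ∷ []} (here refl) = record
  { r₁ = a ; R = a ∷ [] ; r₁∈ = here refl ; R⊆ = id ; r₀∈ = here refl ; rest = inj₁ ; smaller = inj₁ ≤-refl }
shrink {L = a ∷ b ∷ L} (here refl) = record
  { r₁ = b ; R = a ∷ L ; r₁∈ = there (here refl)
  ; R⊆ = λ { (here q) → here q ; (there w∈) → there (there w∈) }
  ; r₀∈ = here refl
  ; rest = λ { (here q) → inj₁ (here q) ; (there (here q)) → inj₂ q ; (there (there w∈)) → inj₁ (there w∈) }
  ; smaller = inj₂ ≤-refl }
shrink {L = a ∷ L} (there r₀∈) = record
  { r₁ = a ; R = L ; r₁∈ = here refl ; R⊆ = there ; r₀∈ = r₀∈
  ; rest = λ { (here q) → inj₂ q ; (there w∈) → inj₁ w∈ }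
  ; smaller = inj₂ ≤-refl }

lookup-injective : ∀ {A : Set} {xs : List A} → Unique xs → ∀ {i j} → lookup xs i ≡ lookup xs j → i ≡ j
lookup-injective (_ ∷ _)  {zero}  {zero}  _ = refl
lookup-injective (p ∷ _)  {zero}  {suc j} q = ⊥-elim (All.lookup p (∈-lookup j) q)
lookup-injective (p ∷ _)  {suc i} {zero}  q = ⊥-elim (All.lookup p (∈-lookup i) (sym q))
lookup-injective (_ ∷ ps) {suc i} {suc j} q = cong suc (lookup-injective ps q)

at-most-one : ∀ {A : Set} {L : List A} {x y} → length L ≤ 1 → x ∈ L → y ∈ L → x ≡ y
at-most-one _ (here refl) (here refl) = refl
at-most-one (s≤s ()) (here _) (there {xs = _ ∷ _} _)
at-most-one (s≤s ()) (there {xs = _ ∷ _} _) _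

-- An added edge affects its two vertices and, in each of the `k` colours, the far ends of the two
-- paths starting there.
edgeCost : ℕ → ℕ
edgeCost k = 2 + (k + k)

-- One edge `xy`, preceded by at most two auxiliary edges for each colour.
gadgetCost : ℕ → ℕ
gadgetCost k = edgeCost k + k * (edgeCost k + edgeCost k)

-- Partial matchings and their contractions.

module Completion {n k : ℕ} (m : Fin k → Fin n → Fin n) (m-pairing : ∀ l → IsPairing (m l)) where

  private
    V : Set
    V = Fin n

  open DecMembership (_≟_ {n = n}) using (_∈?_)

  -- A partial matching s (unmatched vertices are fixed by s) together with the
  -- matchings e l obtained from m l by contracting the edges of s: e l maps an
  -- unmatched vertex to the other end of its path in m l ∪ s.
  record Partial : Set where
    field
      s      : V → V
      s-inv  : ∀ x → s (s x) ≡ x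
      e      : Fin k → V → V
      e-free : ∀ l {x} → s x ≡ x → s (e l x) ≡ e l x
      e-inv  : ∀ l {x} → s x ≡ x → e l (e l x) ≡ x
      e-≢    : ∀ l {x} → s x ≡ x → e l x ≢ x
      e-path : ∀ l {x} → s x ≡ x → Path (m l) s x (e l x)
      e-only : ∀ l {x y} → s x ≡ x → s y ≡ y → Path (m l) s x y → y ≡ x ⊎ y ≡ e l x

    Free : V → Set
    Free x = s x ≡ x

    s-path-sym : ∀ l {x y} → Path (m l) s x y → Path (m l) s y x
    s-path-sym l = path-sym (involutive (m-pairing l)) s-inv

    e-flip : ∀ l {x y} → Free x → e l x ≡ y → e l y ≡ x
    e-flip l fx refl = e-inv l fx

  open Partial public

  empty : Partial
  empty = record
    { s      = id
    ; s-inv  = λ _ → refl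
    ; e      = m
    ; e-free = λ _ _ → refl
    ; e-inv  = λ l _ → involutive (m-pairing l) _
    ; e-≢    = λ l _ → fixedPointFree (m-pairing l) _
    ; e-path = λ l _ → stepˡ _
    ; e-only = λ l _ _ → only l
    }
    where
    only : ∀ l {x y} → Path (m l) id x y → y ≡ x ⊎ y ≡ m l x
    only l ε = inj₁ refl
    only l (inj₂ refl ◅ p) = only l p
    only l (inj₁ refl ◅ p) with only l p
    ... | inj₁ e = inj₂ e
    ... | inj₂ e = inj₁ (trans e (involutive (m-pairing l) _))

  -- The edge `ab` joins the paths of `a` and `b`: a vertex whose path ended in `a` now ends at
  -- `e P l b`, and symmetrically. If `e P l a ≡ b`, the edge closes a cycle in colour `l` and the
  -- vertices that remain free keep their ends.
  module AddEdge (P : Partial) {a b : V} (fa : Free P a) (fb : Free P b) (a≢b : a ≢ b) where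

    module S = Override a b b a (s P)
    module E (l : Fin k) = Override a b (e P l b) (e P l a) id

    t : V → V
    t = S.ov

    ta : t a ≡ b
    ta = S.ov₁ refl

    tb : t b ≡ a
    tb = S.ov₂ (≢-sym a≢b) refl

    s-away : ∀ {c x} → Free P c → x ≢ c → s P x ≢ c
    s-away fc x≢c q = x≢c (trans (sym (flip-≡ (s-inv P) q)) fc)

    t-inv : ∀ x → t (t x) ≡ x
    t-inv x with position a b x
    ... | at₁ refl   = tb
    ... | at₂ _ refl = ta
    ... | away p q   = trans (S.ov₃ (s-away fa p) (s-away fb q)) (s-inv P x)

    s≼t : s P ≼ t
    s≼t x with position a b x
    ... | at₁ refl   = inj₁ fa
    ... | at₂ _ refl = inj₁ fb
    ... | away _ _   = inj₂ refl

    free-old : ∀ {x} → t x ≡ x → Free P x × x ≢ a × x ≢ b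
    free-old {x} q =
      ≼-fixed s≼t q , (λ { refl → a≢b (sym (trans (sym ta) q)) }) ,
      (λ { refl → a≢b (trans (sym tb) q) })

    free-new : ∀ {x} → Free P x → x ≢ a → x ≢ b → t x ≡ x
    free-new fx p q = trans (S.ov₃ p q) fx

    d : Fin k → V → V
    d l x = E.ov l (e P l x)

    d₁ : ∀ l {x} → e P l x ≡ a → d l x ≡ e P l b
    d₁ l = E.ov₁ l

    d₂ : ∀ l {x} → e P l x ≡ b → d l x ≡ e P l a
    d₂ l q = E.ov₂ l (λ q′ → a≢b (trans (sym q′) q)) q

    d₃ : ∀ l {x} → e P l x ≢ a → e P l x ≢ b → d l x ≡ e P l x
    d₃ l = E.ov₃ l

    path-old : ∀ l {x y} → Path (m l) (s P) x y → Path (m l) t x y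
    path-old l = ≼-path s≼t

    a→b : ∀ l → Path (m l) t a b
    a→b l = subst (Path (m l) t a) ta (stepʳ a)

    b→a : ∀ l → Path (m l) t b a
    b→a l = subst (Path (m l) t b) tb (stepʳ b)

    data End (l : Fin k) (x : V) : Set where
      through : ∀ {u v} → e P l x ≡ u → d l x ≡ e P l v → d l (e P l v) ≡ e P l u →
                Path (m l) t u v → Free P v → e P l v ≢ a → e P l v ≢ b → End l x
      direct  : d l x ≡ e P l x → e P l x ≢ a → e P l x ≢ b → End l x

    end : ∀ l {x} → t x ≡ x → End l x
    end l {x} q with free-old q | position a b (e P l x)
    ... | fx , x≢a , x≢b | at₁ r =
      through r (d₁ l r) (d₂ l (e-inv P l fb)) (a→b l) fb
        (λ r′ → x≢b (trans (sym (e-flip P l fx r)) (e-flip P l fb r′))) (e-≢ P l fb)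
    ... | fx , x≢a , x≢b | at₂ _ r =
      through r (d₂ l r) (d₁ l (e-inv P l fa)) (b→a l) fa (e-≢ P l fa)
        (λ r′ → x≢a (trans (sym (e-flip P l fx r)) (e-flip P l fa r′)))
    ... | fx , x≢a , x≢b | away p r = direct (d₃ l p r) p r

    Joined : Fin k → V → V → Set
    Joined l x y = Path (m l) (s P) x y
                 ⊎ (Path (m l) (s P) x a × Path (m l) (s P) b y)
                 ⊎ (Path (m l) (s P) x b × Path (m l) (s P) a y)

    prepend : ∀ l {x y z} → Path (m l) (s P) x y → Joined l y z → Joined l x z
    prepend l p (inj₁ q) = inj₁ (p ◅◅ q)
    prepend l p (inj₂ (inj₁ (q , r))) = inj₂ (inj₁ (p ◅◅ q , r))
    prepend l p (inj₂ (inj₂ (q , r))) = inj₂ (inj₂ (p ◅◅ q , r))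

    -- A path that uses the new edge several times can be cut short by skipping the piece between
    -- two uses, so at most one use remains.
    joined : ∀ l {x y} → Path (m l) t x y → Joined l x y
    joined l ε = inj₁ ε
    joined l (inj₁ refl ◅ p) = prepend l (stepˡ _) (joined l p)
    joined l {x} (inj₂ refl ◅ p) with position a b x | joined l p
    ... | away _ _   | j = prepend l (stepʳ x) j
    ... | at₁ refl   | inj₁ q = inj₂ (inj₁ (ε , q))
    ... | at₁ refl   | inj₂ (inj₁ (_ , q)) = inj₂ (inj₁ (ε , q))
    ... | at₁ refl   | inj₂ (inj₂ (_ , q)) = inj₁ q
    ... | at₂ _ refl | inj₁ q = inj₂ (inj₂ (ε , q))
    ... | at₂ _ refl | inj₂ (inj₁ (_ , q)) = inj₁ q
    ... | at₂ _ refl | inj₂ (inj₂ (_ , q)) = inj₂ (inj₂ (ε , q))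

    path-far : ∀ l {x c} → Free P x → Free P c → x ≢ c → Path (m l) (s P) x c → c ≡ e P l x
    path-far l fx fc x≢c p = [ (λ q → ⊥-elim (x≢c (sym q))) , id ]′ (e-only P l fx fc p)

    result : Partial
    result = record
      { s = t ; s-inv = t-inv ; e = d
      ; e-free = λ l → d-free l ; e-inv = λ l → d-inv l ; e-≢ = λ l → d-≢ l
      ; e-path = λ l → d-path l ; e-only = λ l → d-only l }
      where
      d-free : ∀ l {x} → t x ≡ x → t (d l x) ≡ d l x
      d-free l q with end l q
      ... | through _ r _ _ fv p p′ rewrite r = free-new (e-free P l fv) p p′
      ... | direct r p p′ rewrite r = free-new (e-free P l (proj₁ (free-old q))) p p′

      d-inv : ∀ l {x} → t x ≡ x → d l (d l x) ≡ x
      d-inv l q with end l q | free-old q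
      ... | through r₀ r r′ _ _ _ _ | fx , _ , _ =
        trans (cong (d l) r) (trans r′ (trans (cong (e P l) (sym r₀)) (e-inv P l fx)))
      ... | direct r _ _ | fx , x≢a , x≢b = trans (cong (d l) r) (trans
        (d₃ l (x≢a ∘ trans (sym (e-inv P l fx))) (x≢b ∘ trans (sym (e-inv P l fx)))) (e-inv P l fx))

      d-≢ : ∀ l {x} → t x ≡ x → d l x ≢ x
      d-≢ l q q′ with free-old q | position a b (e P l _)
      ... | fx , x≢a , x≢b | at₁ r =
        a≢b (trans (sym r) (e-flip P l fb (trans (sym (d₁ l r)) q′)))
      ... | fx , x≢a , x≢b | at₂ _ r =
        a≢b (sym (trans (sym r) (e-flip P l fa (trans (sym (d₂ l r)) q′))))
      ... | fx , x≢a , x≢b | away p p′ = e-≢ P l fx (trans (sym (d₃ l p p′)) q′)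

      d-path : ∀ l {x} → t x ≡ x → Path (m l) t x (d l x)
      d-path l q with end l q | free-old q
      ... | through refl r _ uv fv _ _ | fx , _ , _ rewrite r =
        path-old l (e-path P l fx) ◅◅ uv ◅◅ path-old l (e-path P l fv)
      ... | direct r _ _ | fx , _ , _ rewrite r = path-old l (e-path P l fx)

      d-only : ∀ l {x y} → t x ≡ x → t y ≡ y → Path (m l) t x y → y ≡ x ⊎ y ≡ d l x
      d-only l q q′ p with free-old q | free-old q′ | joined l p
      ... | fx , x≢a , x≢b | fy , y≢a , y≢b | inj₁ r with e-only P l fx fy r
      ...   | inj₁ r′ = inj₁ r′
      ...   | inj₂ refl = inj₂ (sym (d₃ l y≢a y≢b))
      d-only l q q′ p | fx , x≢a , x≢b | fy , y≢a , y≢b | inj₂ (inj₁ (r , r′)) =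
        inj₂ (trans (path-far l fb fy (≢-sym y≢b) r′) (sym (d₁ l (sym (path-far l fx fa x≢a r)))))
      d-only l q q′ p | fx , x≢a , x≢b | fy , y≢a , y≢b | inj₂ (inj₂ (r , r′)) =
        inj₂ (trans (path-far l fa fy (≢-sym y≢a) r′) (sym (d₂ l (sym (path-far l fx fb x≢b r)))))

  open AddEdge using (result)

  infix 4 _⇝_

  -- `reaches` says that no free vertex of `P` gets caught on a closed cycle in any colour. This
  -- lets bounds on the number of cycles pass from `Q` back to `P`.
  record _⇝_ (P Q : Partial) : Set where
    field
      extends : s P ≼ s Q
      reaches : ∀ l {x} → Free P x → ∃[ y ] (Free Q y × Path (m l) (s Q) x y)

  open _⇝_

  ⇝-refl : ∀ {P} → P ⇝ P
  ⇝-refl = record { extends = λ _ → inj₂ refl ; reaches = λ _ fx → _ , fx , ε }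

  ⇝-trans : ∀ {P Q R} → P ⇝ Q → Q ⇝ R → P ⇝ R
  ⇝-trans p q = record
    { extends = ≼-trans (extends p) (extends q)
    ; reaches = λ l fx →
        let y , fy , π = reaches p l fx
            z , fz , ρ = reaches q l fy
        in z , fz , ≼-path (extends q) π ◅◅ ρ }

  module _ (P : Partial) {a b : V} (fa : Free P a) (fb : Free P b) (a≢b : a ≢ b) where
    private module A = AddEdge P fa fb a≢b

    -- Unless `a` and `b` are the two ends of one path in colour `l`, both of their paths retain a
    -- free end.
    add-reaches : ∀ l → e P l a ≢ b → ∀ {x} → Free P x →
                  ∃[ y ] (Free A.result y × Path (m l) A.t x y)
    add-reaches l ≢b {x} fx with position a b x
    ... | away p q = x , A.free-new fx p q , ε
    ... | at₁ refl = e P l a , A.free-new (e-free P l fa) (e-≢ P l fa) ≢b , A.path-old l (e-path P l fa)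
    ... | at₂ _ refl = e P l b , A.free-new (e-free P l fb) (≢b ∘ e-flip P l fb) (e-≢ P l fb)
                     , A.path-old l (e-path P l fb)

    add-⇝ : (∀ l → e P l a ≢ b) → P ⇝ A.result
    add-⇝ ≢b = record { extends = A.s≼t ; reaches = λ l → add-reaches l (≢b l) }

  -- Outside `T` the contracted matchings are still the original ones, so a private edge of colour
  -- `j` that avoids `T` is an edge of `e P j` and of no other `e P l`.
  Untouched : Partial → List V → Set
  Untouched P T = ∀ {w} → w ∉ T → Free P w × (∀ l → e P l w ≡ m l w)

  touch : Partial → V → V → List V → List V
  touch P a b T = a ∷ b ∷ tabulate (λ l → e P l a) ++ tabulate (λ l → e P l b) ++ T

  length-touch : ∀ P a b T → length (touch P a b T) ≡ edgeCost k + length T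
  length-touch P a b T = cong (2 +_) (begin
    length (tabulate (λ l → e P l a) ++ tabulate (λ l → e P l b) ++ T)
      ≡⟨ length-++ (tabulate (λ l → e P l a)) ⟩
    length (tabulate (λ l → e P l a)) + length (tabulate (λ l → e P l b) ++ T)
      ≡⟨ cong₂ _+_ (length-tabulate (λ l → e P l a)) (length-++ (tabulate (λ l → e P l b))) ⟩
    k + (length (tabulate (λ l → e P l b)) + length T)
      ≡⟨ cong (λ c → k + (c + length T)) (length-tabulate (λ l → e P l b)) ⟩
    k + (k + length T)
      ≡⟨ sym (+-assoc k k (length T)) ⟩
    k + k + length T ∎)
    where open ≡-Reasoning

  module _ {P : Partial} {a b : V} {T : List V} {w : V} (w∉ : w ∉ touch P a b T) where

    ∉-touch₁ : w ≢ a
    ∉-touch₁ refl = w∉ (here refl)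

    ∉-touch₂ : w ≢ b
    ∉-touch₂ refl = w∉ (there (here refl))

    ∉-touch-end₁ : ∀ l → w ≢ e P l a
    ∉-touch-end₁ l refl = w∉ (there (there (∈-++⁺ˡ (∈-tabulate⁺ l))))

    ∉-touch-end₂ : ∀ l → w ≢ e P l b
    ∉-touch-end₂ l refl =
      w∉ (there (there (∈-++⁺ʳ (tabulate (λ l → e P l a)) (∈-++⁺ˡ (∈-tabulate⁺ l)))))

    ∉-touch-rest : w ∉ T
    ∉-touch-rest w∈T = w∉ (there (there
      (∈-++⁺ʳ (tabulate (λ l → e P l a)) (∈-++⁺ʳ (tabulate (λ l → e P l b)) w∈T))))

  -- The end of `w` in colour `l` changes only if it was `a` or `b`, that is, only if `w` is
  -- `e P l a` or `e P l b`; `touch` lists exactly these besides `a`, `b` and `T`.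
  add-untouched : ∀ P {a b T} (fa : Free P a) (fb : Free P b) (a≢b : a ≢ b) →
                  Untouched P T → Untouched (result P fa fb a≢b) (touch P a b T)
  add-untouched P {a} {b} {T} fa fb a≢b U {w} w∉ with U (∉-touch-rest {P} {a} {b} {T} w∉)
  ... | fw , ew =
    A.free-new fw (∉-touch₁ {P} {a} {b} {T} w∉) (∉-touch₂ {P} {a} {b} {T} w∉) , λ l →
    trans (A.d₃ l (λ q → ∉-touch-end₁ {P} {a} {b} {T} w∉ l (sym (e-flip P l fw q)))
                  (λ q → ∉-touch-end₂ {P} {a} {b} {T} w∉ l (sym (e-flip P l fw q)))) (ew l)
    where module A = AddEdge P fa fb a≢b

  -- Rebuilds the edges of `t` outside `Z` one at a time, so as to obtain the contraction of a
  -- finished matching to the vertices of `Z`. `L` lists the vertices already treated.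
  restrict : ∀ {t} → IsPairing t → (Z : List V) → (∀ {z} → z ∈ Z → t z ∈ Z) → (L : List V) →
             ∃[ P ] (s P ≼ t × (∀ {w} → w ∈ L → w ∈ Z ⊎ s P w ≡ t w) × (∀ {z} → z ∈ Z → Free P z))
  restrict pt Z Z-closed [] = empty , (λ _ → inj₁ refl) , (λ ()) , λ _ → refl
  restrict {t} pt Z Z-closed (v ∷ L) with restrict pt Z Z-closed L
  ... | P , P≼t , done , Z-free with v ∈? Z | s P v ≟ t v
  ...   | yes v∈Z | _ = P , P≼t , (λ { (here refl) → inj₁ v∈Z ; (there q) → done q }) , Z-free
  ...   | no _ | yes q = P , P≼t , (λ { (here refl) → inj₂ q ; (there q) → done q }) , Z-free
  ...   | no v∉Z | no q = A.result , A≼t , A-done , λ z∈Z →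
    A.free-new (Z-free z∈Z) (λ { refl → v∉Z z∈Z })
      (λ { refl → v∉Z (subst (_∈ Z) (involutive pt v) (Z-closed z∈Z)) })
    where
    fv : Free P v
    fv = [ id , (λ r → ⊥-elim (q (sym r))) ]′ (P≼t v)
    ftv : Free P (t v)
    ftv = [ id , (λ r → ⊥-elim (q (flip-≡ {f = s P} (s-inv P) (trans (sym r) (involutive pt v))))) ]′ (P≼t (t v))
    module A = AddEdge P fv ftv (≢-sym (fixedPointFree pt v))
    A≼t : A.t ≼ t
    A≼t w with position v (t v) w
    ... | at₁ refl   = inj₂ refl
    ... | at₂ _ refl = inj₂ (involutive pt v)
    ... | away _ _   = P≼t w
    A-done : ∀ {w} → w ∈ v ∷ L → w ∈ Z ⊎ A.t w ≡ t w
    A-done (here refl) = inj₂ A.ta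
    A-done {w} (there w∈L) with done w∈L
    ... | inj₁ w∈Z = inj₁ w∈Z
    ... | inj₂ r = inj₂ (trans ([ (λ r′ → ⊥-elim (fixedPointFree pt w (trans (sym r) r′))) , id ]′ (A.s≼t w)) r)

  -- Switching two edges of a perfect matching.

  _PreservesPathsOf_in-colour_ : (V → V) → (V → V) → Fin k → Set
  t′ PreservesPathsOf t in-colour l = ∀ {u v} → Path (m l) t u v → Path (m l) t′ u v

  -- With `b = t a` and `d = t c`, `R₁` replaces `ab`, `cd` by `ac`, `bd`, and `R₂` replaces them by
  -- `ad`, `bc`. Contracting all other edges of `t` leaves, in each colour, a perfect matching of
  -- the four corners, and the partner of `a` in it decides how the cycles change.
  module Switch {t : V → V} (pt : IsPairing t) {a c : V} (c≢a : c ≢ a) (c≢ta : c ≢ t a) where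

    b d : V
    b = t a
    d = t c

    corners : List V
    corners = a ∷ b ∷ c ∷ d ∷ []

    d≢a : d ≢ a
    d≢a q = c≢ta (sym (pairing-flip pt q))

    d≢b : d ≢ b
    d≢b q = c≢a (trans (sym (involutive pt c)) (trans (cong t q) (involutive pt a)))

    module R₁ = Rewire pt c≢a c≢ta
    module R₂ = Rewire pt d≢a d≢b

    corners-closed : ∀ {z} → z ∈ corners → t z ∈ corners
    corners-closed (here refl) = there (here refl)
    corners-closed (there (here refl)) = here (involutive pt a)
    corners-closed (there (there (here refl))) = there (there (there (here refl)))
    corners-closed (there (there (there (here refl)))) = there (there (here (involutive pt c)))

    restricted = restrict pt corners corners-closed (allFin n)

    P : Partial
    P = proj₁ restricted

    P≼t : s P ≼ t
    P≼t = proj₁ (proj₂ restricted)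

    P-off : ∀ {w} → w ∉ corners → s P w ≡ t w
    P-off {w} w∉ = [ (λ q → ⊥-elim (w∉ q)) , id ]′ (proj₁ (proj₂ (proj₂ restricted)) (∈-allFin w))

    P-free : ∀ {w} → w ∈ corners → Free P w
    P-free = proj₂ (proj₂ (proj₂ restricted))

    -- Off the corners `s P` agrees with `t`, which has no fixed points, so every free vertex is a
    -- corner.
    end∈ : ∀ l {z} → z ∈ corners → e P l z ∈ corners
    end∈ l {z} z∈ with e P l z ∈? corners
    ... | yes q = q
    ... | no q = ⊥-elim (fixedPointFree pt (e P l z) (trans (sym (P-off q)) (e-free P l (P-free z∈))))

    AgreesOff : (V → V) → Set
    AgreesOff t′ = ∀ {w} → w ∉ corners → t′ w ≡ t w

    agrees₁ : AgreesOff R₁.t′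
    agrees₁ w∉ = R₁.off (w∉ ∘ here) (w∉ ∘ there ∘ here) (w∉ ∘ there ∘ there ∘ here)
                        (w∉ ∘ there ∘ there ∘ there ∘ here)

    agrees₂ : AgreesOff R₂.t′
    agrees₂ w∉ = R₂.off (w∉ ∘ here) (w∉ ∘ there ∘ here) (w∉ ∘ there ∘ there ∘ there ∘ here)
                        (λ q → w∉ (there (there (here (trans q (involutive pt c))))))

    module _ (l : Fin k) {t′ : V → V} (agrees : AgreesOff t′) where

      lift : ∀ {u v} → Path (m l) (s P) u v → Path (m l) t′ u v
      lift = ≼-path ≼t′
        where
        ≼t′ : s P ≼ t′
        ≼t′ w with w ∈? corners
        ... | yes q = inj₁ (P-free q)
        ... | no q  = inj₂ (trans (agrees q) (sym (P-off q)))

      preserves : IsPairing t′ → Path (m l) t′ a b → Path (m l) t′ c d → t′ PreservesPathsOf t in-colour l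
      preserves pt′ ab cd = path-reroute reroute
        where
        back : ∀ {u v} → Path (m l) t′ u v → Path (m l) t′ v u
        back = path-sym (involutive (m-pairing l)) (involutive pt′)
        reroute : ∀ w → Path (m l) t′ w (t w)
        reroute w with w ∈? corners
        ... | yes (here refl) = ab
        ... | yes (there (here refl)) = subst (Path (m l) t′ b) (sym (involutive pt a)) (back ab)
        ... | yes (there (there (here refl))) = cd
        ... | yes (there (there (there (here refl)))) =
          subst (Path (m l) t′ d) (sym (involutive pt c)) (back cd)
        ... | no w∉ = subst (Path (m l) t′ w) (agrees w∉) (stepʳ w)

    end-path : ∀ l {z y} → z ∈ corners → e P l z ≡ y → Path (m l) (s P) z y
    end-path l z∈ refl = e-path P l (P-free z∈)

    edge : ∀ l {t′ : V → V} {u v} → t′ u ≡ v → Path (m l) t′ u v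
    edge l refl = stepʳ _

    Mono₁ Mono₂ : Fin k → Set
    Mono₁ l = R₁.t′ PreservesPathsOf t in-colour l
    Mono₂ l = R₂.t′ PreservesPathsOf t in-colour l

    t′b≡c : R₂.t′ b ≡ c
    t′b≡c = trans R₂.ta↦ (involutive pt c)

    a∈ : a ∈ corners
    a∈ = here refl

    c∈ : c ∈ corners
    c∈ = there (there (here refl))

    both : ∀ l → (∀ {t′} → AgreesOff t′ → Path (m l) t′ a b) →
           Path (m l) R₁.t′ c d → Path (m l) R₂.t′ c d → Mono₁ l × Mono₂ l
    both l ab cd₁ cd₂ = preserves l agrees₁ R₁.pairing (ab agrees₁) cd₁
                      , preserves l agrees₂ R₂.pairing (ab agrees₂) cd₂

    -- When the path from a in colour l ends in c or d, exactly one of the two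
    -- reconnections keeps the cycle together; otherwise both do.
    switch : ∀ l → (Mono₁ l ⊎ Mono₂ l) × (¬ Path (m l) t a c → Mono₁ l × Mono₂ l)
    switch l with e P l a in ea | end∈ l a∈
    ... | _ | here refl = ⊥-elim (e-≢ P l (P-free a∈) ea)
    ... | _ | there (here refl) = inj₁ (proj₁ monos) , λ _ → monos
      where
      ab : ∀ {t′} → AgreesOff t′ → Path (m l) t′ a b
      ab agrees = lift l agrees (end-path l a∈ ea)
      monos : Mono₁ l × Mono₂ l
      -- As `a` and `b` are each other's ends here, the end of `c` can only be `d`. The cases of `a`
      -- and `b` are answered by explicit paths instead of being refuted.
      monos with e P l c in ec | end∈ l c∈
      ... | _ | here refl =
        both l ab (lift l agrees₁ (end-path l c∈ ec) ◅◅ ab agrees₁ ◅◅ edge l R₁.ta↦)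
                  (lift l agrees₂ (end-path l c∈ ec) ◅◅ edge l R₂.a↦)
      ... | _ | there (here refl) =
        both l ab (lift l agrees₁ (end-path l c∈ ec) ◅◅ edge l R₁.ta↦)
                  (lift l agrees₂ (end-path l c∈ ec ◅◅ s-path-sym P l (end-path l a∈ ea)) ◅◅ edge l R₂.a↦)
      ... | _ | there (there (here refl)) = ⊥-elim (e-≢ P l (P-free c∈) ec)
      ... | _ | there (there (there (here refl))) =
        both l ab (lift l agrees₁ (end-path l c∈ ec)) (lift l agrees₂ (end-path l c∈ ec))
    ... | _ | there (there (here refl)) =
        inj₂ (preserves l agrees₂ R₂.pairing
               (lift l agrees₂ a~c ◅◅ edge l (pairing-flip R₂.pairing t′b≡c))
               (lift l agrees₂ (s-path-sym P l a~c) ◅◅ edge l R₂.a↦))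
      , λ a≁c → ⊥-elim (a≁c (≼-path P≼t a~c))
      where
      a~c : Path (m l) (s P) a c
      a~c = end-path l a∈ ea
    ... | _ | there (there (there (here refl))) =
        inj₁ (preserves l agrees₁ R₁.pairing
               (lift l agrees₁ a~d ◅◅ edge l (pairing-flip R₁.pairing R₁.ta↦))
               (edge l (pairing-flip R₁.pairing R₁.a↦) ◅◅ lift l agrees₁ a~d))
      , λ a≁c → ⊥-elim (a≁c (≼-path P≼t a~d ◅◅ edge l (involutive pt c)))
      where
      a~d : Path (m l) (s P) a d
      a~d = end-path l a∈ ea

  -- Completions with few cycles.

  record Completed (P : Partial) (bound : Fin k → ℕ) : Set where
    field
      t       : V → V
      pairing : IsPairing t
      extends : s P ≼ t
      -- Every cycle of colour `l` that meets a free vertex of `P` contains a representative, so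
      -- `suc (bound l)` bounds the number of these cycles. For `empty` and bound 0 the union is
      -- connected.
      reps    : Fin k → List V
      reps⊆   : ∀ l {r} → r ∈ reps l → Free P r
      few     : ∀ l → length (reps l) ≤ suc (bound l)
      covers  : ∀ l {w} → Free P w → ∃[ r ] (r ∈ reps l × Path (m l) t w r)

  all-connected : ∀ {bound} → Completed empty bound → (∀ l → bound l ≡ 0) →
                  ∃[ t ] (IsPairing t × (∀ l u v → Path (m l) t u v))
  all-connected D bound≡0 = D.t , D.pairing , λ l u v →
    let r , r∈ , p = D.covers l {u} refl
        r′ , r′∈ , q = D.covers l {v} refl
    in subst (Path (m l) D.t u) (at-most-one (subst (λ b → _ ≤ suc b) (bound≡0 l) (D.few l)) r∈ r′∈) p
       ◅◅ path-sym (involutive (m-pairing l)) (involutive D.pairing) q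
    where module D = Completed D

  pull-back : ∀ {P Q bound} → P ⇝ Q → Completed Q bound → Completed P bound
  pull-back p D = record
    { t = D.t ; pairing = D.pairing ; extends = ≼-trans (extends p) D.extends
    ; reps = D.reps ; reps⊆ = λ l r∈ → ≼-fixed (extends p) (D.reps⊆ l r∈) ; few = D.few
    ; covers = λ l fw → let v , fv , π = reaches p l fw
                            r , r∈ , ρ = D.covers l fv
                        in r , r∈ , ≼-path D.extends π ◅◅ ρ }
    where module D = Completed D

  -- When no partner for `u` is left, every free vertex is `u` or one of its ends `e P l u`. These
  -- at most `k + 1` vertices represent themselves in every colour.
  greedy : Fin k → ∀ L P → (∀ {w} → Free P w → w ∈ L) → Completed P (λ _ → k)
  greedy _ [] P free⊆ = record
    { t = s P
    ; pairing = record { involutive = s-inv P ; fixedPointFree = λ x fx → ∉[] (free⊆ fx) }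
    ; extends = λ _ → inj₂ refl
    ; reps = λ _ → [] ; reps⊆ = λ _ () ; few = λ _ → z≤n ; covers = λ _ fw → ⊥-elim (∉[] (free⊆ fw)) }
    where
    ∉[] : ∀ {w : V} → w ∉ []
    ∉[] ()
  greedy l₀ (u ∷ L) P free⊆ with s P u ≟ u
  ... | no ¬fu = greedy l₀ L P (λ fw → drop fw (free⊆ fw))
    where
    drop : ∀ {w} → Free P w → w ∈ u ∷ L → w ∈ L
    drop fw (here refl) = ⊥-elim (¬fu fw)
    drop fw (there w∈)  = w∈
  ... | yes fu
    with any? (λ v → (s P v ≟ v) ×-dec ¬? (v ≟ u) ×-dec all? (λ l → ¬? (v ≟ e P l u)))
  ...   | yes (v , fv , v≢u , v≢e) =
    pull-back (add-⇝ P fu fv (≢-sym v≢u) (λ l q → v≢e l (sym q)))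
              (greedy l₀ L A.result (λ ft → drop ft (free⊆ (proj₁ (A.free-old ft)))))
    where
    module A = AddEdge P fu fv (≢-sym v≢u)
    drop : ∀ {w} → Free A.result w → w ∈ u ∷ L → w ∈ L
    drop ft (here refl) = ⊥-elim (proj₁ (proj₂ (A.free-old ft)) refl)
    drop ft (there w∈)  = w∈
  ...   | no stuck = record
    { t = t
    ; pairing = record { involutive = t-inv ; fixedPointFree = t-fpf }
    ; extends = extends-t
    ; reps = λ _ → filter (λ w → s P w ≟ w) R
    ; reps⊆ = λ _ r∈ → proj₂ (∈-filter⁻ (λ w → s P w ≟ w) {xs = R} r∈)
    ; few = λ _ → ≤-trans (length-filter (λ w → s P w ≟ w) R)
                          (≤-reflexive (cong suc (length-tabulate (λ l → e P l u))))
    ; covers = λ _ fw → _ , ∈-filter⁺ (λ w → s P w ≟ w) (free∈R fw) fw , ε }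
    where
    R : List V
    R = u ∷ tabulate (λ l → e P l u)
    free∈R : ∀ {w} → Free P w → w ∈ R
    free∈R {w} fw with w ∈? R
    ... | yes w∈ = w∈
    ... | no w∉  = ⊥-elim (stuck (w , fw , (w∉ ∘ here) ,
                     λ { l refl → w∉ (there (∈-tabulate⁺ l)) }))
    -- The remaining free vertices are matched by the contracted matching of an arbitrary colour
    -- `l₀`, since `e P l₀` is already a pairing of them.
    t : V → V
    t w with s P w ≟ w
    ... | yes _ = e P l₀ w
    ... | no _  = s P w
    t-free : ∀ {w} → Free P w → t w ≡ e P l₀ w
    t-free {w} fw with s P w ≟ w
    ... | yes _ = refl
    ... | no ¬f = ⊥-elim (¬f fw)
    t-matched : ∀ {w} → ¬ Free P w → t w ≡ s P w
    t-matched {w} ¬fw with s P w ≟ w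
    ... | yes f = ⊥-elim (¬fw f)
    ... | no _  = refl
    t-inv : ∀ w → t (t w) ≡ w
    t-inv w with s P w ≟ w
    ... | yes fw = trans (t-free (e-free P l₀ fw)) (e-inv P l₀ fw)
    ... | no ¬fw = trans (t-matched (λ f → ¬fw (sym (trans (sym (s-inv P w)) f)))) (s-inv P w)
    t-fpf : ∀ w → t w ≢ w
    t-fpf w with s P w ≟ w
    ... | yes fw = e-≢ P l₀ fw
    ... | no ¬fw = ¬fw
    extends-t : s P ≼ t
    extends-t w with s P w ≟ w
    ... | yes fw = inj₁ fw
    ... | no _   = inj₂ refl

  -- Construction of gadgets from private edges.

  module Gadgets (C : ℕ)
    (fresh : ∀ j T → length T < C →
             ∃[ w ] (w ∉ T × m j w ∉ T × (∀ l → l ≢ j → m l w ≢ m j w))) where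

    -- `x` and `y` are to become the two ends of one path in the colours of `J`, but not in colour
    -- `i`. `keep` allows the colours to be treated one after another, and `b` is the budget of
    -- vertices touched on the way.
    record Linked (P : Partial) (T : List V) (i : Fin k) (x y : V) (J : Fin k → Set) (b : ℕ) : Set where
      field
        Q         : Partial
        T′        : List V
        untouched : Untouched Q T′
        size      : length T′ ≤ b + length T
        ext       : P ⇝ Q
        fx        : Free Q x
        fy        : Free Q y
        apart     : e Q i x ≢ y
        keep      : ∀ p → e P p x ≡ y → e Q p x ≡ y
        linked    : ∀ p → J p → e Q p x ≡ y

    -- The new edges u w and w′ v route the path from x through the private edge w w′
    -- to v and on to y; only colour j takes this route, as m l w ≢ w′ for l ≢ j.
    module Link (P : Partial) (T : List V) (U : Untouched P T) {i j : Fin k} (j≢i : j ≢ i)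
                {x y : V} (fx : Free P x) (fy : Free P y) (x≢y : x ≢ y)
                (apart : e P i x ≢ y) (unlinked : e P j x ≢ y)
                {w : V} (w∉ : w ∉ touch P x y (touch P (e P j x) (e P j y) T))
                (w′∉ : m j w ∉ touch P x y (touch P (e P j x) (e P j y) T))
                (private-w : ∀ l → l ≢ j → m l w ≢ m j w) where

      u v w′ : V
      u = e P j x
      v = e P j y
      w′ = m j w

      fu : Free P u
      fu = e-free P j fx

      fv : Free P v
      fv = e-free P j fy

      module Avoid {z : V} (z∉ : z ∉ touch P x y (touch P u v T)) where
        z∉′ : z ∉ touch P u v T
        z∉′ = ∉-touch-rest {P} {x} {y} z∉

        z∉T : z ∉ T
        z∉T = ∉-touch-rest {P} {u} {v} z∉′

        fz : Free P z
        fz = proj₁ (U z∉T)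

        ez : ∀ l → e P l z ≡ m l z
        ez = proj₂ (U z∉T)

        ≢x : z ≢ x
        ≢x = ∉-touch₁ {P} {x} {y} z∉

        ≢y : z ≢ y
        ≢y = ∉-touch₂ {P} {x} {y} z∉

        ≢u : z ≢ u
        ≢u = ∉-touch₁ {P} {u} {v} z∉′

        ≢v : z ≢ v
        ≢v = ∉-touch₂ {P} {u} {v} z∉′

        end≢x : ∀ l → e P l z ≢ x
        end≢x l q = ∉-touch-end₁ {P} {x} {y} z∉ l (sym (e-flip P l fz q))

        end≢y : ∀ l → e P l z ≢ y
        end≢y l q = ∉-touch-end₂ {P} {x} {y} z∉ l (sym (e-flip P l fz q))

        end≢u : ∀ l → e P l z ≢ u
        end≢u l q = ∉-touch-end₁ {P} {u} {v} z∉′ l (sym (e-flip P l fz q))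

        end≢v : ∀ l → e P l z ≢ v
        end≢v l q = ∉-touch-end₂ {P} {u} {v} z∉′ l (sym (e-flip P l fz q))

      module W = Avoid w∉
      module W′ = Avoid w′∉

      y≢u : y ≢ u
      y≢u = ≢-sym unlinked

      x≢v : x ≢ v
      x≢v q = unlinked (e-flip P j fy (sym q))

      u≢v : u ≢ v
      u≢v q = x≢y (trans (sym (e-inv P j fx)) (trans (cong (e P j) q) (e-inv P j fy)))

      w≢w′ : w ≢ w′
      w≢w′ q = fixedPointFree (m-pairing j) w (sym q)

      e-w : ∀ l → l ≢ j → e P l w ≢ w′
      e-w l l≢j q = private-w l l≢j (trans (sym (W.ez l)) q)

      e-w′ : ∀ l → l ≢ j → e P l w′ ≢ w
      e-w′ l l≢j q = e-w l l≢j (e-flip P l W′.fz q)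

      module A = AddEdge P fu W.fz (≢-sym W.≢u)

      fw′₁ : Free A.result w′
      fw′₁ = A.free-new W′.fz W′.≢u (≢-sym w≢w′)

      fv₁ : Free A.result v
      fv₁ = A.free-new fv (≢-sym u≢v) (≢-sym W.≢v)

      module B = AddEdge A.result fw′₁ fv₁ W′.≢v

      open-A : ∀ l → e P l u ≢ w
      open-A l q = W.end≢u l (e-flip P l fu q)

      -- In colour `j` the edge `uw` has made `x`, the former end of `u`, the end of `w′`, and `x`
      -- is not `v` because `x` and `y` were not linked. In any other colour `uw` leaves the end of
      -- `w′` unchanged, and `w′` was chosen so that this end is not `v`.
      open-B : ∀ l → A.d l w′ ≢ v
      open-B l q with l ≟ j
      ... | yes refl = x≢v (begin
        x           ≡⟨ sym (e-inv P j fx) ⟩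
        e P j u     ≡⟨ sym (A.d₂ j (trans (W′.ez j) (involutive (m-pairing j) w))) ⟩
        A.d j w′    ≡⟨ q ⟩
        v           ∎)
        where open ≡-Reasoning
      ... | no l≢j = W′.end≢v l (trans (sym (A.d₃ l (W′.end≢u l) (e-w′ l l≢j))) q)

      linked-j : B.d j x ≡ y
      linked-j = begin
        B.d j x  ≡⟨ B.d₁ j (trans (A.d₁ j refl) (W.ez j)) ⟩
        A.d j v  ≡⟨ A.d₃ j (λ q → y≢u (trans (sym vy) q)) (λ q → W.≢y (trans (sym q) vy)) ⟩
        e P j v  ≡⟨ vy ⟩
        y        ∎
        where
        open ≡-Reasoning
        vy : e P j v ≡ y
        vy = e-inv P j fy

      keep-p : ∀ p → e P p x ≡ y → B.d p x ≡ y
      keep-p p q = trans (B.d₃ p (λ r → W′.≢y (trans (sym r) q₁))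
                                 (λ r → e-≢ P j fy (trans (sym r) q₁))) q₁
        where
        q₁ : A.d p x ≡ y
        q₁ = trans (A.d₃ p (λ r → y≢u (trans (sym q) r)) (λ r → W.≢y (trans (sym r) q))) q

      i≢j : i ≢ j
      i≢j = ≢-sym j≢i

      -- If the path of `x` in colour `i` ended in `u` or `v`, it now ends at `e P i w` or
      -- `e P i w′`, and both differ from `y` because `w` and `w′` avoid the ends of `y`. The other
      -- avoided ends, together with the privacy of the edge `w w′`, keep the path from using both
      -- new edges.
      apart-i : B.d i x ≢ y
      apart-i q = split (position u w (e P i x))
        where
        split : ¬ Position u w (e P i x)
        split (at₁ r) = W.end≢y i (trans (sym (trans
            (B.d₃ i (λ r′ → e-w i i≢j (trans (sym d≡) r′)) (λ r′ → W.end≢v i (trans (sym d≡) r′))) d≡)) q)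
          where
          d≡ : A.d i x ≡ e P i w
          d≡ = A.d₁ i r
        split (at₂ _ r) = W.end≢x i (e-flip P i fx r)
        split (away r r′) with e P i x ≟ v
        ... | yes t = W′.end≢y i (trans (sym (trans (B.d₂ i (trans (A.d₃ i r r′) t))
                                                    (A.d₃ i (W′.end≢u i) (e-w′ i i≢j)))) q)
        ... | no t  = apart (trans (sym (trans
            (B.d₃ i (λ t′ → W′.end≢x i (e-flip P i fx (trans (sym d≡) t′))) (λ t′ → t (trans (sym d≡) t′))) d≡)) q)
          where
          d≡ : A.d i x ≡ e P i x
          d≡ = A.d₃ i r r′

      linked : Linked P T i x y (_≡ j) (edgeCost k + edgeCost k)
      linked = record
        { Q = B.result
        ; T′ = touch A.result w′ v (touch P u w T)
        ; untouched = add-untouched A.result {T = touch P u w T} fw′₁ fv₁ W′.≢v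
                        (add-untouched P fu W.fz (≢-sym W.≢u) U)
        ; size = ≤-reflexive (trans (length-touch A.result w′ v (touch P u w T)) (trans
                   (cong (edgeCost k +_) (length-touch P u w T)) (sym (+-assoc (edgeCost k) (edgeCost k) (length T)))))
        ; ext = ⇝-trans (add-⇝ P fu W.fz (≢-sym W.≢u) open-A)
                        (add-⇝ A.result fw′₁ fv₁ W′.≢v open-B)
        ; fx = B.free-new (A.free-new fx (≢-sym (e-≢ P j fx)) (≢-sym W.≢x)) (≢-sym W′.≢x) x≢v
        ; fy = B.free-new (A.free-new fy y≢u (≢-sym W.≢y)) (≢-sym W′.≢y) (≢-sym (e-≢ P j fy))
        ; apart = apart-i
        ; keep = keep-p
        ; linked = λ { p refl → linked-j } }

    unchanged : ∀ {P T i x y} {J : Fin k → Set} b → Untouched P T → Free P x → Free P y → e P i x ≢ y →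
                (∀ p → J p → e P p x ≡ y) → Linked P T i x y J b
    unchanged {P} {T} b U fx fy apart linked = record
      { Q = P ; T′ = T ; untouched = U ; size = m≤n+m (length T) b ; ext = ⇝-refl
      ; fx = fx ; fy = fy ; apart = apart ; keep = λ _ q → q ; linked = linked }

    link : ∀ P T → Untouched P T → ∀ i j {x y} → Free P x → Free P y → x ≢ y → e P i x ≢ y →
           edgeCost k + edgeCost k + length T < C → Linked P T i x y (λ p → p ≢ i × p ≡ j) (edgeCost k + edgeCost k)
    link P T U i j {x} {y} fx fy x≢y apart room with j ≟ i | e P j x ≟ y
    ... | yes j≡i | _ = unchanged _ U fx fy apart λ { p (p≢i , refl) → ⊥-elim (p≢i j≡i) }
    ... | no _ | yes q = unchanged _ U fx fy apart λ { p (_ , refl) → q }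
    ... | no j≢i | no unlinked
      -- `touch` serves here as a list of forbidden vertices: `x`, `y`, `e P j x`, `e P j y` and
      -- their ends in all colours. Its length exceeds that of `T` by exactly the cost of the two
      -- edges to be added.
      with fresh j (touch P x y (touch P (e P j x) (e P j y) T))
             (subst (_< C) (sym (trans (length-touch P x y _) (trans
               (cong (edgeCost k +_) (length-touch P (e P j x) (e P j y) T)) (sym (+-assoc (edgeCost k) (edgeCost k) (length T)))))) room)
    ... | w , w∉ , w′∉ , private-w = record
      { Linked (Link.linked P T U j≢i fx fy x≢y apart unlinked w∉ w′∉ private-w) hiding (linked)
      ; linked = λ p r → Linked.linked (Link.linked P T U j≢i fx fy x≢y apart unlinked w∉ w′∉ private-w) p (proj₂ r) }

    link-all : ∀ js P T → Untouched P T → ∀ i {x y} → Free P x → Free P y → x ≢ y → e P i x ≢ y →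
               length js * (edgeCost k + edgeCost k) + length T < C →
               Linked P T i x y (λ p → p ≢ i × p ∈ js) (length js * (edgeCost k + edgeCost k))
    link-all [] P T U i fx fy x≢y apart room = unchanged _ U fx fy apart λ { _ (_ , ()) }
    link-all (j ∷ js) P T U i {x} {y} fx fy x≢y apart room = record
      { Q = R.Q ; T′ = R.T′ ; untouched = R.untouched
      ; size = ≤-trans R.size (≤-trans (+-monoʳ-≤ (length js * c) L.size) (≤-reflexive shift))
      ; ext = ⇝-trans L.ext R.ext
      ; fx = R.fx ; fy = R.fy ; apart = R.apart
      ; keep = λ p q → R.keep p (L.keep p q)
      ; linked = λ { p (p≢i , here q) → R.keep p (L.linked p (p≢i , q))
                   ; p (p≢i , there q) → R.linked p (p≢i , q) } }
      where
      c : ℕ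
      c = edgeCost k + edgeCost k
      shift : length js * c + (c + length T) ≡ c + length js * c + length T
      shift = trans (sym (+-assoc (length js * c) c (length T))) (cong (_+ length T) (+-comm (length js * c) c))
      module L = Linked (link P T U i j fx fy x≢y apart
        (≤-trans (s≤s (+-monoˡ-≤ (length T) (m≤m+n c (length js * c)))) room))
      module R = Linked (link-all js L.Q L.T′ L.untouched i L.fx L.fy x≢y L.apart
        (≤-trans (s≤s (≤-trans (+-monoʳ-≤ (length js * c) L.size) (≤-reflexive shift))) room))

    -- In each colour l ≢ i the new edge xy lies on a cycle, in colour i on a path.
    record Gadget (P : Partial) (T : List V) (i : Fin k) : Set where
      field
        Q         : Partial
        T′        : List V
        untouched : Untouched Q T′
        size      : length T′ ≤ gadgetCost k + length T
        extends   : s P ≼ s Q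
        {x y}     : V
        fx        : Free P x
        fy        : Free P y
        x≢y       : x ≢ y
        sx        : s Q x ≡ y
        reaches   : ∀ l {w} → Free P w → (∃[ r ] (Free Q r × Path (m l) (s Q) w r))
                                       ⊎ (l ≢ i × Path (m l) (s Q) w x)
        x-reaches : ∃[ r ] (Free Q r × Path (m i) (s Q) x r)
        closed    : ∀ l → l ≢ i → ∀ {w} → Path (m l) (s Q) x w → ¬ Free Q w

    gadget : ∀ P T → Untouched P T → ∀ i → gadgetCost k + length T < C → Gadget P T i
    gadget P T U i room with fresh i T (≤-trans (s≤s (m≤n+m _ _)) room)
    ... | x , x∉ , x′∉ , _
      -- Avoiding `m i x`, the end of `x`, ensures that `x` and `y` start out apart in colour `i`.
      -- As `edgeCost k` is at least 2, there is room for the two extra forbidden vertices.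
      with fresh i (x ∷ m i x ∷ T) (≤-trans (s≤s (+-monoˡ-≤ (length T) (s≤s (s≤s z≤n)))) room)
    ... | y , y∉ , _ , _ = record
      { Q = A.result
      ; T′ = touch L.Q x y L.T′
      ; untouched = add-untouched L.Q {T = L.T′} L.fx L.fy x≢y L.untouched
      ; size = ≤-trans (≤-reflexive (length-touch L.Q x y L.T′)) (≤-trans (+-monoʳ-≤ (edgeCost k) L.size)
          (≤-reflexive (trans (sym (+-assoc (edgeCost k) (length (allFin k) * c) (length T)))
                              (cong (λ a → edgeCost k + a * c + length T) (length-tabulate (id {A = Fin k}))))))
      ; extends = ≼-trans (extends L.ext) A.s≼t
      ; fx = fx ; fy = fy ; x≢y = x≢y ; sx = A.ta
      ; reaches = reaches′
      ; x-reaches = add-reaches L.Q L.fx L.fy x≢y i L.apart L.fx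
      ; closed = closed }
      where
      c : ℕ
      c = edgeCost k + edgeCost k
      x≢y : x ≢ y
      x≢y q = y∉ (here (sym q))
      fx : Free P x
      fx = proj₁ (U x∉)
      fy : Free P y
      fy = proj₁ (U (y∉ ∘ there ∘ there))
      module L = Linked (link-all (allFin k) P T U i fx fy x≢y
        (λ q → y∉ (there (here (trans (sym q) (proj₂ (U x∉) i)))))
        (≤-trans (s≤s (+-monoˡ-≤ (length T) (≤-trans
          (≤-reflexive (cong (_* c) (length-tabulate (id {A = Fin k})))) (m≤n+m _ (edgeCost k))))) room))
      module A = AddEdge L.Q L.fx L.fy x≢y
      ex : ∀ l → l ≢ i → e L.Q l x ≡ y
      ex l l≢i = L.linked l (l≢i , ∈-allFin l)
      reaches′ : ∀ l {w} → Free P w → (∃[ r ] (Free A.result r × Path (m l) A.t w r))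
                                    ⊎ (l ≢ i × Path (m l) A.t w x)
      reaches′ l fw with l ≟ i | reaches L.ext l fw
      ... | yes refl | v , fv , p =
        let r , fr , q = add-reaches L.Q L.fx L.fy x≢y i L.apart fv in inj₁ (r , fr , A.path-old l p ◅◅ q)
      ... | no l≢i | v , fv , p with position x y v
      ...   | at₁ refl   = inj₂ (l≢i , A.path-old l p)
      ...   | at₂ _ refl = inj₂ (l≢i , A.path-old l p ◅◅ A.b→a l)
      ...   | away q q′  = inj₁ (v , A.free-new fv q q′ , A.path-old l p)
      -- In colour `l` the path through `x` had just the ends `x` and `y`, and both are now matched.
      closed : ∀ l → l ≢ i → ∀ {w} → Path (m l) A.t x w → ¬ Free A.result w
      closed l l≢i p fw with A.free-old fw | A.joined l p
      ... | f , w≢x , w≢y | inj₁ q =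
        [ w≢x , (λ r → w≢y (trans r (ex l l≢i))) ]′ (e-only L.Q l L.fx f q)
      ... | f , w≢x , w≢y | inj₂ (inj₁ (_ , q)) =
        [ w≢y , (λ r → w≢x (trans r (e-flip L.Q l L.fx (ex l l≢i)))) ]′ (e-only L.Q l L.fy f q)
      ... | f , w≢x , w≢y | inj₂ (inj₂ (_ , q)) =
        [ w≢x , (λ r → w≢y (trans r (ex l l≢i))) ]′ (e-only L.Q l L.fx f q)

    -- Using up the gadgets to lower the numbers of cycles.

    count : Fin k → List (Fin k) → ℕ
    count l is = length (filter (_≟ l) is)

    -- `r₀` represents the cycle of `x` in colour `i`, and `r₁` is the representative to be dropped.
    -- Switching `xy` with the edge of `t` at `r₁` brings `x` and `r₁` together in every colour: in
    -- colour `i` this lets `r₀` stand for `r₁`, and in the others it lets `r₁` reach the closed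
    -- cycle of `x`, which has no representative of its own.
    module Unwind {P T i} (G : Gadget P T i) {bound bound′ : Fin k → ℕ}
                  (same : ∀ l → l ≢ i → bound l ≤ bound′ l) (less : bound i ≤ suc (bound′ i))
                  (D : Completed (Gadget.Q G) bound) where

      open Gadget G using (Q; x; y; fx; fy; x≢y; sx; closed; x-reaches)
      module D = Completed D
      open D using (t; pairing)

      tx : t x ≡ y
      tx = trans ([ (λ q → ⊥-elim (x≢y (trans (sym q) sx))) , id ]′ (D.extends x)) sx

      x-rep : ∃[ r ] (r ∈ D.reps i × Path (m i) t x r)
      x-rep = let v , fv , p = x-reaches
                  r , r∈ , q = D.covers i fv
              in r , r∈ , ≼-path D.extends p ◅◅ q

      r₀ : V
      r₀ = proj₁ x-rep

      x~r₀ : Path (m i) t x r₀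
      x~r₀ = proj₂ (proj₂ x-rep)

      module S = Shrunk (shrink (proj₁ (proj₂ x-rep)))
      open S using (r₁)

      fr₁ : Free Q r₁
      fr₁ = D.reps⊆ i S.r₁∈

      r₁≢x : r₁ ≢ x
      r₁≢x q = x≢y (trans (sym (subst (Free Q) q fr₁)) sx)

      r₁≢tx : r₁ ≢ t x
      r₁≢tx q = x≢y (trans (sym (s-inv Q x)) (trans (cong (s Q) sx) (subst (Free Q) (trans q tx) fr₁)))

      -- The component of `x` under `s Q` contains no free vertex, so `t` agrees with `s Q` on it
      -- and cannot leave it.
      closed-t : ∀ l → l ≢ i → ∀ {u v} → Path (m l) (s Q) x u → Path (m l) t u v → Path (m l) (s Q) x v
      closed-t l l≢i p ε = p
      closed-t l l≢i p (inj₁ refl ◅ q) = closed-t l l≢i (p ◅◅ stepˡ _) q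
      closed-t l l≢i {u} p (inj₂ refl ◅ q) = closed-t l l≢i
        (subst (Path (m l) (s Q) x)
          (sym ([ (λ fu → ⊥-elim (closed l l≢i p fu)) , id ]′ (D.extends u)))
          (p ◅◅ stepʳ u)) q

      x≁r₁ : ∀ l → l ≢ i → ¬ Path (m l) t x r₁
      x≁r₁ l l≢i p = closed l l≢i (closed-t l l≢i ε p) fr₁

      module W = Switch pairing r₁≢x r₁≢tx

      record Merged : Set where
        field
          t′       : V → V
          pairing′ : IsPairing t′
          agrees   : W.AgreesOff t′
          mono     : ∀ l → t′ PreservesPathsOf t in-colour l
          x~r₁     : ∀ l → Path (m l) t′ x r₁

      in-all-colours : ∀ {t′} → t′ PreservesPathsOf t in-colour i →
                       (∀ l → l ≢ i → t′ PreservesPathsOf t in-colour l) →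
                       ∀ l → t′ PreservesPathsOf t in-colour l
      in-all-colours p q l with l ≟ i
      ... | yes refl = p
      ... | no l≢i   = q l l≢i

      merged : Merged
      merged with proj₁ (W.switch i)
      ... | inj₁ p = record
        { t′ = W.R₁.t′ ; pairing′ = W.R₁.pairing ; agrees = W.agrees₁
        ; mono = in-all-colours p (λ l l≢i → proj₁ (proj₂ (W.switch l) (x≁r₁ l l≢i)))
        ; x~r₁ = λ l → W.edge l W.R₁.a↦ }
      ... | inj₂ p = record
        { t′ = W.R₂.t′ ; pairing′ = W.R₂.pairing ; agrees = W.agrees₂ ; mono = mono
        -- `R₂` pairs `x` with `t r₁`; the former edge from `t r₁` to `r₁` survives as a path.
        ; x~r₁ = λ l → W.edge l W.R₂.a↦ ◅◅ mono l (W.edge l (involutive pairing r₁)) }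
        where
        mono = in-all-colours p (λ l l≢i → proj₂ (proj₂ (W.switch l) (x≁r₁ l l≢i)))

      module M = Merged merged

      r₁~x : ∀ l → Path (m l) M.t′ r₁ x
      r₁~x l = path-sym (involutive (m-pairing l)) (involutive M.pairing′) (M.x~r₁ l)

      -- The switch changes only edges at vertices free in `P`, so the edges of `s P`, those of
      -- earlier gadgets included, stay in place. The vertex `t r₁` is free in `Q` because its
      -- partner `r₁` is.
      corners-free : ∀ {w} → w ∈ W.corners → Free P w
      corners-free (here refl) = fx
      corners-free (there (here refl)) = subst (Free P) (sym tx) fy
      corners-free (there (there (here refl))) = ≼-fixed (Gadget.extends G) fr₁
      corners-free (there (there (there (here refl)))) = ≼-fixed (Gadget.extends G) ftr₁
        where
        ftr₁ : Free Q (t r₁)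
        ftr₁ = [ id , (λ q → ⊥-elim (fixedPointFree pairing r₁ (trans
                 (sym (flip-≡ {f = s Q} (s-inv Q) (trans (sym q) (involutive pairing r₁)))) fr₁))) ]′ (D.extends (t r₁))

      extends′ : s P ≼ M.t′
      extends′ w with w ∈? W.corners
      ... | yes w∈ = inj₁ (corners-free w∈)
      ... | no w∉ with ≼-trans (Gadget.extends G) D.extends w
      ...   | inj₁ q = inj₁ q
      ...   | inj₂ q = inj₂ (trans (M.agrees w∉) q)

      record Reps (l : Fin k) : Set where
        field
          R   : List V
          R⊆  : ∀ {r} → r ∈ R → Free P r
          few : length R ≤ suc (bound′ l)
          cov : ∀ {w} → Free P w → ∃[ r ] (r ∈ R × Path (m l) M.t′ w r)

      free-covered : ∀ l {w} → Free Q w → ∃[ r ] (r ∈ D.reps l × Path (m l) M.t′ w r)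
      free-covered l fw = let r , r∈ , p = D.covers l fw in r , r∈ , M.mono l p

      reps′ : ∀ l → Reps l
      reps′ l with l ≟ i
      ... | no l≢i = record
        { R = D.reps l
        ; R⊆ = λ r∈ → ≼-fixed (Gadget.extends G) (D.reps⊆ l r∈)
        ; few = ≤-trans (D.few l) (s≤s (same l l≢i))
        ; cov = cov }
        where
        cov : ∀ {w} → Free P w → ∃[ r ] (r ∈ D.reps l × Path (m l) M.t′ w r)
        cov fw with Gadget.reaches G l fw
        ... | inj₁ (v , fv , p) = let r , r∈ , q = free-covered l fv
                                  in r , r∈ , M.mono l (≼-path D.extends p) ◅◅ q
        ... | inj₂ (_ , p) = let r , r∈ , q = free-covered l fr₁
                             in r , r∈ , M.mono l (≼-path D.extends p) ◅◅ M.x~r₁ l ◅◅ q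
      ... | yes refl = record
        { R = S.R
        ; R⊆ = λ r∈ → ≼-fixed (Gadget.extends G) (D.reps⊆ i (S.R⊆ r∈))
        -- A list of length at most 1 is allowed even if `bound′ i` is 0; otherwise dropping `r₁`
        -- pays for the decrease of the bound.
        ; few = [ (λ q → ≤-trans q (s≤s z≤n)) , (λ q → ≤-pred (≤-trans q (≤-trans (D.few i) (s≤s less)))) ]′ S.smaller
        ; cov = cov }
        where
        cov : ∀ {w} → Free P w → ∃[ r ] (r ∈ S.R × Path (m i) M.t′ w r)
        cov fw with Gadget.reaches G i fw
        ... | inj₂ (i≢i , _) = ⊥-elim (i≢i refl)
        ... | inj₁ (v , fv , p) with free-covered i fv
        ...   | r , r∈ , q with S.rest r∈
        ...     | inj₁ r∈R  = r , r∈R , M.mono i (≼-path D.extends p) ◅◅ q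
        ...     | inj₂ refl = r₀ , S.r₀∈ , M.mono i (≼-path D.extends p) ◅◅ q ◅◅ r₁~x i ◅◅ M.mono i x~r₀

      unwound : Completed P bound′
      unwound = record
        { t = M.t′ ; pairing = M.pairing′ ; extends = extends′
        ; reps = λ l → Reps.R (reps′ l) ; reps⊆ = λ l → Reps.R⊆ (reps′ l)
        ; few = λ l → Reps.few (reps′ l) ; covers = λ l → Reps.cov (reps′ l) }

    -- Gadgets are added along the list and switched in reverse order, so each switch finds the
    -- earlier gadgets intact inside `s P`. The bound is `k` after `greedy` and drops by one in
    -- colour `i` for each occurrence of `i`.
    complete : Fin k → ∀ is P T → Untouched P T → length is * gadgetCost k + length T < C →
               Completed P (λ l → k ∸ count l is)
    complete l₀ [] P T U room = greedy l₀ (allFin n) P (λ _ → ∈-allFin _)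
    complete l₀ (i ∷ is) P T U room =
      Unwind.unwound G {bound = λ l → k ∸ count l is} same less
        (complete l₀ is G.Q G.T′ G.untouched
          (≤-trans (s≤s (≤-trans (+-monoʳ-≤ (length is * gadgetCost k) G.size) (≤-reflexive shift))) room))
      where
      shift : length is * gadgetCost k + (gadgetCost k + length T) ≡ gadgetCost k + length is * gadgetCost k + length T
      shift = trans (sym (+-assoc (length is * gadgetCost k) (gadgetCost k) (length T)))
                    (cong (_+ length T) (+-comm (length is * gadgetCost k) (gadgetCost k)))
      G : Gadget P T i
      G = gadget P T U i (≤-trans (s≤s (+-monoˡ-≤ (length T) (m≤m+n (gadgetCost k) (length is * gadgetCost k)))) room)
      module G = Gadget G
      same : ∀ l → l ≢ i → k ∸ count l is ≤ k ∸ count l (i ∷ is)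
      same l l≢i with i ≟ l
      ... | yes q = ⊥-elim (l≢i (sym q))
      ... | no _  = ≤-refl
      less : k ∸ count i is ≤ suc (k ∸ count i (i ∷ is))
      less with i ≟ i
      ... | yes _ = ≤-trans (suc-pred-≤ (k ∸ count i is)) (s≤s (≤-reflexive (pred[m∸n]≡m∸[1+n] k (count i is))))
        where
        suc-pred-≤ : ∀ a → a ≤ suc (pred a)
        suc-pred-≤ zero    = z≤n
        suc-pred-≤ (suc a) = ≤-refl
      ... | no i≢i = ⊥-elim (i≢i refl)

    vertex : Fin k → 2 < C → V
    vertex l₀ 2<C = proj₁ (fresh l₀ [] (≤-trans (s≤s z≤n) 2<C))

    3≤n : Fin k → 2 < C → 3 ≤ n
    3≤n l₀ 2<C with vertex l₀ 2<C
    ... | v with fresh l₀ (v ∷ m l₀ v ∷ []) 2<C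
    ...   | w , w∉ , _ = injective⇒≤ {f = lookup (v ∷ m l₀ v ∷ w ∷ [])} (lookup-injective
      ((≢-sym (fixedPointFree (m-pairing l₀) v) ∷ (λ q → w∉ (here (sym q))) ∷ [])
       ∷ ((λ q → w∉ (there (here (sym q)))) ∷ []) ∷ [] ∷ []))

-- The cyclic tour of a connected union of two pairings.

toℕ-next : ∀ {n} (i : Fin n) → toℕ (next i) ≡ suc (toℕ i) ⊎ (toℕ (next i) ≡ 0 × suc (toℕ i) ≡ n)
toℕ-next {suc n} i with m≤n⇒m<n∨m≡n (toℕ<n i)
... | inj₁ i+1<n = inj₁ (trans (toℕ-fromℕ< (m%n<n (suc (toℕ i)) (suc n))) (m<n⇒m%n≡m i+1<n))
... | inj₂ i+1≡n = inj₂ (trans (toℕ-fromℕ< (m%n<n (suc (toℕ i)) (suc n)))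
                               (trans (cong (_% suc n) i+1≡n) (n%n≡0 (suc n))) , i+1≡n)

module Cycle {n : ℕ} {f g : Fin n → Fin n} (pf : IsPairing f) (pg : IsPairing g) (v₀ : Fin n) where

  op : ℕ → Fin n → Fin n
  op 0 = f
  op 1 = g
  op (suc (suc t)) = op t

  op-pairing : ∀ t → IsPairing (op t)
  op-pairing 0 = pf
  op-pairing 1 = pg
  op-pairing (suc (suc t)) = op-pairing t

  op-split : ∀ t → (op t ≡ f × op (suc t) ≡ g) ⊎ (op t ≡ g × op (suc t) ≡ f)
  op-split 0 = inj₁ (refl , refl)
  op-split 1 = inj₂ (refl , refl)
  op-split (suc (suc t)) = op-split t

  walk : ℕ → Fin n
  walk zero    = v₀
  walk (suc t) = op t (walk t)

  walk-back : ∀ t → op t (walk (suc t)) ≡ walk t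
  walk-back t = involutive (op-pairing t) (walk t)

  -- This is `2 * d + t`, with the successors outermost so that `op` and `walk` compute.
  even+ : ℕ → ℕ → ℕ
  even+ zero    t = t
  even+ (suc d) t = suc (suc (even+ d t))

  even+-suc : ∀ d t → even+ d (suc t) ≡ suc (even+ d t)
  even+-suc zero    t = refl
  even+-suc (suc d) t = cong (2 +_) (even+-suc d t)

  even+-0 : ∀ d t → even+ d t ≡ even+ d 0 + t
  even+-0 zero    t = refl
  even+-0 (suc d) t = cong (2 +_) (even+-0 d t)

  op-even+ : ∀ d t → op (even+ d t) ≡ op t
  op-even+ zero    t = refl
  op-even+ (suc d) t = op-even+ d t

  parity : ∀ c t → ∃[ d ] (c + t ≡ even+ d t ⊎ c + t ≡ suc (even+ d t))
  parity zero t = 0 , inj₁ refl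
  parity (suc c) t with parity c t
  ... | d , inj₁ q = d , inj₂ (cong suc q)
  ... | d , inj₂ q = suc d , inj₁ (cong suc q)

  -- A closed walk of odd length would be a palindrome, folded at a fixed point of f or g.
  no-odd-return : ∀ d t → walk t ≢ walk (suc (even+ d t))
  no-odd-return zero t q = fixedPointFree (op-pairing t) (walk t) (sym q)
  no-odd-return (suc d) t q = no-odd-return d (suc t) (begin
    op t (walk t)                              ≡⟨ cong (op t) q ⟩
    op t (walk (suc (suc (suc (even+ d t)))))  ≡⟨ cong (λ h → h (walk (suc (suc (suc (even+ d t)))))) (sym (op-even+ (suc d) t)) ⟩
    op (suc (suc (even+ d t))) (walk (suc (suc (suc (even+ d t)))))
                                               ≡⟨ walk-back (suc (suc (even+ d t))) ⟩
    walk (suc (suc (even+ d t)))               ≡⟨ cong (walk ∘ suc) (sym (even+-suc d t)) ⟩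
    walk (suc (even+ d (suc t)))               ∎)
    where open ≡-Reasoning

  -- Steps at times of equal parity use the same involution, so a coincidence can be traced
  -- backwards to time 0.
  shift-down : ∀ d t → walk t ≡ walk (even+ d t) → walk 0 ≡ walk (even+ d 0)
  shift-down d zero    q = q
  shift-down d (suc t) q = shift-down d t (begin
    walk t                             ≡⟨ sym (walk-back t) ⟩
    op t (walk (suc t))                ≡⟨ cong (op t) (trans q (cong walk (even+-suc d t))) ⟩
    op t (walk (suc (even+ d t)))      ≡⟨ cong (λ h → h (walk (suc (even+ d t)))) (sym (op-even+ d t)) ⟩
    op (even+ d t) (walk (suc (even+ d t))) ≡⟨ walk-back (even+ d t) ⟩
    walk (even+ d t)                   ∎)
    where open ≡-Reasoning

  -- The index `suc d` makes `period` visibly a successor, as `%` and `/` require.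
  module Period (d : ℕ) (return : walk 0 ≡ walk (even+ (suc d) 0)) where

    period : ℕ
    period = even+ (suc d) 0

    shift : ∀ t → walk t ≡ walk (even+ (suc d) t)
    shift zero    = return
    shift (suc t) = begin
      op t (walk t)                       ≡⟨ cong (op t) (shift t) ⟩
      op t (walk (even+ (suc d) t))       ≡⟨ cong (λ h → h (walk (even+ (suc d) t))) (sym (op-even+ (suc d) t)) ⟩
      walk (suc (even+ (suc d) t))        ≡⟨ cong walk (sym (even+-suc (suc d) t)) ⟩
      walk (even+ (suc d) (suc t))        ∎
      where open ≡-Reasoning

    shifts : ∀ j t → walk (t + j * period) ≡ walk t
    shifts zero    t = cong walk (+-comm t 0)
    shifts (suc j) t = begin
      walk (t + (period + j * period))   ≡⟨ cong walk (trans (sym (+-assoc t period _)) (trans (cong (_+ j * period) (+-comm t period)) (+-assoc period t _))) ⟩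
      walk (period + (t + j * period))   ≡⟨ cong walk (sym (even+-0 (suc d) (t + j * period))) ⟩
      walk (even+ (suc d) (t + j * period)) ≡⟨ sym (shift (t + j * period)) ⟩
      walk (t + j * period)              ≡⟨ shifts j t ⟩
      walk t                             ∎
      where open ≡-Reasoning

    walk-mod : ∀ t → walk (t % period) ≡ walk t
    walk-mod t = sym (trans (cong walk (m≡m%n+[m/n]*n t period)) (shifts (t / period) (t % period)))

    previous : ∀ t → ∃[ q ] (walk q ≡ op (suc t) (walk t) × walk (suc q) ≡ walk t)
    previous (suc t) = t , sym (walk-back t) , refl
    previous zero = suc (even+ d 0) , (begin
      walk (suc (even+ d 0))                             ≡⟨ sym (walk-back (suc (even+ d 0))) ⟩
      op (suc (even+ d 0)) (walk (even+ (suc d) 0))      ≡⟨ cong₂ (λ t h → op t h) (sym (even+-suc d 0)) (sym return) ⟩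
      op (even+ d 1) (walk 0)                            ≡⟨ cong (λ h → h (walk 0)) (op-even+ d 1) ⟩
      op 1 (walk 0)                                      ∎) , sym return
      where open ≡-Reasoning

    neighbours : ∀ t {v} → Step f g (walk t) v →
                 walk (suc t) ≡ v ⊎ ∃[ q ] (walk q ≡ v × walk (suc q) ≡ walk t)
    neighbours t step with op-split t | step
    ... | inj₁ (p , _) | inj₁ refl = inj₁ (cong (λ h → h (walk t)) p)
    ... | inj₂ (p , _) | inj₂ refl = inj₁ (cong (λ h → h (walk t)) p)
    ... | inj₁ (_ , p) | inj₂ refl =
      let q , a , b = previous t in inj₂ (q , trans a (cong (λ h → h (walk t)) p) , b)
    ... | inj₂ (_ , p) | inj₁ refl =
      let q , a , b = previous t in inj₂ (q , trans a (cong (λ h → h (walk t)) p) , b)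

    visits : ∀ t {v} → Path f g (walk t) v → ∃[ u ] walk u ≡ v
    visits t ε = t , refl
    visits t (step ◅ p) with neighbours t step
    ... | inj₁ refl = visits (suc t) p
    ... | inj₂ (q , refl , _) = visits q p

  module _ (connected : ∀ v → Path f g v₀ v) where

    -- Reduced modulo the period, the walk still visits every vertex, so distinct vertices have
    -- distinct times below the period.
    n≤period : ∀ d → walk 0 ≡ walk (even+ (suc d) 0) → n ≤ even+ (suc d) 0
    n≤period d return = injective⇒≤ {f = time} λ {u} {v} q → begin
      u                     ≡⟨ sym (walk-time u) ⟩
      walk (toℕ (time u))   ≡⟨ cong (walk ∘ toℕ) q ⟩
      walk (toℕ (time v))   ≡⟨ walk-time v ⟩
      v                     ∎
      where
      open ≡-Reasoning
      open Period d return
      time : Fin n → Fin period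
      time v = proj₁ (visits 0 (connected v)) mod period
      walk-time : ∀ v → walk (toℕ (time v)) ≡ v
      walk-time v = trans (cong walk (toℕ-fromℕ< (m%n<n (proj₁ (visits 0 (connected v))) period)))
        (trans (walk-mod (proj₁ (visits 0 (connected v)))) (proj₂ (visits 0 (connected v))))

    -- An odd gap is excluded by `no-odd-return`, and an even one moves back to time 0 by
    -- `shift-down`.
    return : ∀ a b → a < b → walk a ≡ walk b →
             ∃[ d ] (b ≡ even+ (suc d) a × walk 0 ≡ walk (even+ (suc d) 0))
    return a b a<b q with parity (b ∸ suc a) (suc a)
    ... | d , inj₁ r = ⊥-elim (no-odd-return d a (trans q (cong walk
            (trans (sym (m∸n+n≡m a<b)) (trans r (even+-suc d a))))))
    ... | d , inj₂ r = d , b≡ , shift-down (suc d) a (trans q (cong walk b≡))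
      where
      b≡ : b ≡ even+ (suc d) a
      b≡ = trans (sym (m∸n+n≡m a<b)) (trans r (cong suc (even+-suc d a)))

    no-early-return : ∀ {a b} → a < b → b < n → walk a ≢ walk b
    no-early-return {a} {b} a<b b<n q with return a b a<b q
    ... | d , b≡ , r = <⇒≱ b<n (≤-trans (n≤period d r)
            (≤-trans (m≤m+n _ a) (≤-reflexive (trans (sym (even+-0 (suc d) a)) (sym b≡)))))

    walk-injective : ∀ {a b} → a < n → b < n → walk a ≡ walk b → a ≡ b
    walk-injective {a} {b} a<n b<n q with <-cmp a b
    ... | tri< a<b _ _ = ⊥-elim (no-early-return a<b b<n q)
    ... | tri≈ _ a≡b _ = a≡b
    ... | tri> _ _ b<a = ⊥-elim (no-early-return b<a a<n (sym q))

    -- Two of the `n + 1` times from 0 to `n` coincide, which gives a period of at most `n`; by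
    -- `n≤period` it is exactly `n`.
    return-at-n : ∃[ d ] (n ≡ even+ (suc d) 0 × walk 0 ≡ walk (even+ (suc d) 0))
    return-at-n with pigeonhole {n} ≤-refl (walk ∘ toℕ)
    ... | i , j , i<j , q with return (toℕ i) (toℕ j) i<j q
    ...   | d , j≡ , r = d , ≤-antisym (n≤period d r) (≤-trans (m≤m+n _ (toℕ i))
              (≤-trans (≤-reflexive (trans (sym (even+-0 (suc d) (toℕ i))) (sym j≡))) (≤-pred (toℕ<n j)))) , r

    private
      d₀ : ℕ
      d₀ = proj₁ return-at-n

      n≡ : n ≡ even+ (suc d₀) 0
      n≡ = proj₁ (proj₂ return-at-n)

      open Period d₀ (proj₂ (proj₂ return-at-n))

      <n : ∀ t → t % period < n
      <n t = subst (t % period <_) (sym n≡) (m%n<n t period)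

      reduce : ℕ → Fin n
      reduce t = fromℕ< (<n t)

      walk-reduce : ∀ t → walk (toℕ (reduce t)) ≡ walk t
      walk-reduce t = trans (cong walk (toℕ-fromℕ< (<n t))) (walk-mod t)

      time : Fin n → Fin n
      time v = reduce (proj₁ (visits 0 (connected v)))

      walk-time : ∀ v → walk (toℕ (time v)) ≡ v
      walk-time v = trans (walk-reduce (proj₁ (visits 0 (connected v)))) (proj₂ (visits 0 (connected v)))

    tour : Permutation′ n
    tour = permutation (walk ∘ toℕ) time walk-time
      λ i → toℕ-injective (walk-injective (toℕ<n _) (toℕ<n i) (walk-time (walk (toℕ i))))

    walk-next : ∀ i → walk (toℕ (next i)) ≡ walk (suc (toℕ i))
    walk-next i with toℕ-next i
    ... | inj₁ q = cong walk q
    ... | inj₂ (q , r) = trans (cong walk q) (trans (shift 0) (cong walk (sym (trans r n≡))))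

    tour-step : ∀ i → Step f g (tour ⟨$⟩ʳ i) (tour ⟨$⟩ʳ next i)
    tour-step i with op-split (toℕ i)
    ... | inj₁ (p , _) = inj₁ (trans (cong (λ h → h (walk (toℕ i))) (sym p)) (sym (walk-next i)))
    ... | inj₂ (p , _) = inj₂ (trans (cong (λ h → h (walk (toℕ i))) (sym p)) (sym (walk-next i)))

    Consecutive : Fin n → Fin n → Set
    Consecutive u v = ∃[ i ] ((u ≡ tour ⟨$⟩ʳ i × v ≡ tour ⟨$⟩ʳ next i)
                            ⊎ (v ≡ tour ⟨$⟩ʳ i × u ≡ tour ⟨$⟩ʳ next i))

    step⇒consecutive : ∀ {u v} → Step f g u v → Consecutive u v
    step⇒consecutive {u} {v} step
      with neighbours (toℕ (time u)) (subst (λ w → Step f g w v) (sym (walk-time u)) step)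
    ... | inj₁ q = time u , inj₁ (sym (walk-time u) , trans (sym q) (sym (walk-next (time u))))
    ... | inj₂ (t , a , b) = reduce t , inj₂ (trans (sym a) (sym (walk-reduce t)) , (begin
      u                                    ≡⟨ sym (walk-time u) ⟩
      walk (toℕ (time u))                  ≡⟨ sym b ⟩
      walk (suc t)                         ≡⟨ sym (trans (walk-next (reduce t)) (suc-reduce t)) ⟩
      walk (toℕ (next (reduce t)))         ∎))
      where
      open ≡-Reasoning
      suc-reduce : ∀ t → walk (suc (toℕ (reduce t))) ≡ walk (suc t)
      suc-reduce t = begin
        walk (suc (toℕ (reduce t)))        ≡⟨ cong (walk ∘ suc) (toℕ-fromℕ< (<n t)) ⟩
        walk (suc (t % period))            ≡⟨ sym (shifts (t / period) (suc (t % period))) ⟩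
        walk (suc (t % period + t / period * period)) ≡⟨ cong (walk ∘ suc) (sym (m≡m%n+[m/n]*n t period)) ⟩
        walk (suc t)                       ∎

    consecutive⇒step : ∀ {u v} → Consecutive u v → Step f g u v
    consecutive⇒step (i , inj₁ (refl , refl)) = tour-step i
    consecutive⇒step (i , inj₂ (refl , refl)) =
      [ inj₁ ∘ flip-≡ {f = f} (involutive pf) , inj₂ ∘ flip-≡ {f = g} (involutive pg) ]′ (tour-step i)

-- Edge sets, pairings and the counting of edges.

unique⇒length≤ : ∀ {A B : Set} {xs : List A} {ys : List B} (R : A → B → Set) →
                 (∀ {x x′ y} → R x y → R x′ y → x ≡ x′) → Unique xs →
                 (∀ {x} → x ∈ xs → ∃[ y ] (y ∈ ys × R x y)) → length xs ≤ length ys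
unique⇒length≤ {xs = xs} {ys} R R-inj unique hit = injective⇒≤ {f = image} λ {i} {j} q →
  lookup-injective unique (R-inj (R-image i) (subst (R (lookup xs j) ∘ lookup ys) (sym q) (R-image j)))
  where
  image : Fin (length xs) → Fin (length ys)
  image i = Any.index (proj₁ (proj₂ (hit (∈-lookup i))))
  R-image : ∀ i → R (lookup xs i) (lookup ys (image i))
  R-image i = let y , y∈ , r = hit (∈-lookup i) in subst (R (lookup xs i)) (lookup-index y∈) r

T-does : ∀ {P : Set} (P? : Dec P) → T (does P?) ⇔ P
T-does (yes p) = mk⇔ (λ _ → p) _
T-does (no ¬p) = mk⇔ (λ ()) ¬p

T-not : ∀ b → T (not b) → ¬ T b
T-not false _ ()

module _ {n : ℕ} where

  module _ {t : Fin n → Fin n} (pt : IsPairing t) where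

    edges : EdgeSet n
    edges = record
      { adj    = λ u v → does (t u ≟ v)
      ; sym    = λ u v → does-⇔ (mk⇔ (pairing-flip pt) (pairing-flip pt)) (t u ≟ v) (t v ≟ u)
      ; irrefl = λ u → dec-false (t u ≟ u) (fixedPointFree pt u) }

    ∈-edges : ∀ u v → [ u , v ]∈ edges ⇔ t u ≡ v
    ∈-edges u v = T-does (t u ≟ v)

    edges-perfect : IsPerfectMatching edges
    edges-perfect = record
      { disjoint = λ u v w p q → trans (sym (to (∈-edges u v) p)) (to (∈-edges u w) q)
      ; covering = λ u → t u , from (∈-edges u (t u)) refl }

  module _ {M : EdgeSet n} (pM : IsPerfectMatching M) where

    open IsPerfectMatching pM

    mate : Fin n → Fin n
    mate u = proj₁ (covering u)

    ∈⇔mate : ∀ u v → [ u , v ]∈ M ⇔ mate u ≡ v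
    ∈⇔mate u v = mk⇔ (disjoint u (mate u) v (proj₂ (covering u))) λ { refl → proj₂ (covering u) }

    mate-pairing : IsPairing mate
    mate-pairing = record
      { involutive = λ u → to (∈⇔mate (mate u) u)
          (subst T (EdgeSet.sym M u (mate u)) (proj₂ (covering u)))
      ; fixedPointFree = λ u q → subst T (EdgeSet.irrefl M u) (from (∈⇔mate u u) q) }

  ∈-⋃ : ∀ {E : EdgeSet n} {Es u v} → E ∈ Es → [ u , v ]∈ E → [ u , v ]∈ ⋃ Es
  ∈-⋃ {E} (here refl) p = from T-∨ (inj₁ p)
  ∈-⋃ {Es = F ∷ _} {u} {v} (there q) p = from (T-∨ {adj F u v}) (inj₂ (∈-⋃ q p))

  ∈-⋃≢ : ∀ {k} {M : Fin k → EdgeSet n} {i l u v} → l ≢ i → [ u , v ]∈ M l → [ u , v ]∈ ⋃≢ i M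
  ∈-⋃≢ {M = M} {i} {l} l≢i =
    ∈-⋃ (∈-map⁺ M (∈-filter⁺ (λ j → ¬? (j ≟ i)) (∈-allFin l) l≢i))

  -- Each vertex of `T′` lies on at most one edge of a matching, so if every edge met `T′` there
  -- would be at most `length T′` edges.
  edge-avoiding : ∀ (E : EdgeSet n) (T′ : List (Fin n)) →
                  (∀ {u v w} → [ u , v ]∈ E → [ u , w ]∈ E → v ≡ w) → length T′ < ∣ E ∣ →
                  ∃[ u ] ∃[ v ] (u ∉ T′ × v ∉ T′ × [ u , v ]∈ E)
  edge-avoiding E T′ matching T′<E = search (Any.any? (λ (u , v) → ¬? (u ∈? T′) ×-dec ¬? (v ∈? T′)) L)
    where
    open DecMembership (_≟_ {n = n}) using (_∈?_)
    Edge : Fin n × Fin n → Set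
    Edge (u , v) = u Fin.< v × [ u , v ]∈ E
    edge? : ∀ e → Dec (Edge e)
    edge? (u , v) = (u <? v) ×-dec T? (adj E u v)
    L : List (Fin n × Fin n)
    L = filter edge? (cartesianProduct (allFin n) (allFin n))
    edge : ∀ {e} → e ∈ L → Edge e
    edge e∈ = proj₂ (∈-filter⁻ edge? {xs = cartesianProduct (allFin n) (allFin n)} e∈)
    Meets : Fin n × Fin n → Fin n → Set
    Meets (u , v) w = Edge (u , v) × (u ≡ w ⊎ v ≡ w)
    swap : ∀ {u v} → [ u , v ]∈ E → [ v , u ]∈ E
    swap {u} {v} = subst T (EdgeSet.sym E u v)
    meets-inj : ∀ {e e′ w} → Meets e w → Meets e′ w → e ≡ e′
    meets-inj ((_ , p) , inj₁ refl) ((_ , q) , inj₁ refl) = cong (_ ,_) (matching p q)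
    meets-inj ((_ , p) , inj₂ refl) ((_ , q) , inj₂ refl) = cong (_, _) (matching (swap p) (swap q))
    -- The shared vertex is the smaller end of one edge and the larger end of the other; by the
    -- matching property the opposite ends coincide, which contradicts the orientation.
    meets-inj ((u<v , p) , inj₁ refl) ((u′<u , q) , inj₂ refl) =
      ⊥-elim (<-asym u<v (subst (Fin._< _) (sym (matching p (swap q))) u′<u))
    meets-inj ((v<u , p) , inj₂ refl) ((u<v′ , q) , inj₁ refl) =
      ⊥-elim (<-asym v<u (subst (_ Fin.<_) (sym (matching (swap p) q)) u<v′))
    unique : Unique L
    unique = Unique.filter⁺ edge? (Unique.cartesianProduct⁺ (Unique.allFin⁺ n) (Unique.allFin⁺ n))
    search : Dec (Any.Any (λ (u , v) → u ∉ T′ × v ∉ T′) L) → ∃[ u ] ∃[ v ] (u ∉ T′ × v ∉ T′ × [ u , v ]∈ E)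
    search (yes p) = let (u , v) , e∈ , u∉ , v∉ = find p in u , v , u∉ , v∉ , proj₂ (edge e∈)
    search (no ¬p) = ⊥-elim (<⇒≱ T′<E (unique⇒length≤ Meets meets-inj unique hit))
      where
      hit : ∀ {e} → e ∈ L → ∃[ w ] (w ∈ T′ × Meets e w)
      hit {u , v} e∈ with u ∈? T′ | v ∈? T′
      ... | yes u∈ | _      = u , u∈ , edge e∈ , inj₁ refl
      ... | no _   | yes v∈ = v , v∈ , edge e∈ , inj₂ refl
      ... | no u∉  | no v∉  = ⊥-elim (¬p (lose e∈ (u∉ , v∉)))

  hamiltonian : 3 ≤ n → ∀ {t} (pt : IsPairing t) {M} (pM : IsPerfectMatching M) (v₀ : Fin n) →
                (∀ v → Path (mate pM) t v₀ v) → IsHamiltonCycle (edges pt ∪ M)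
  hamiltonian 3≤n {t} pt {M} pM v₀ connected = record
    { 3≤n = 3≤n
    ; σ = tour connected
    ; edges = λ u v → mk⇔ (step⇒consecutive connected ∘ step) (unstep ∘ consecutive⇒step connected) }
    where
    open Cycle (mate-pairing pM) pt v₀
    step : ∀ {u v} → [ u , v ]∈ edges pt ∪ M → Step (mate pM) t u v
    step {u} {v} = [ inj₂ ∘ to (∈-edges pt u v) , inj₁ ∘ to (∈⇔mate pM u v) ]′ ∘ to T-∨
    unstep : ∀ {u v} → Step (mate pM) t u v → [ u , v ]∈ edges pt ∪ M
    unstep {u} {v} = from T-∨ ∘ [ inj₂ ∘ from (∈⇔mate pM u v) , inj₁ ∘ from (∈-edges pt u v) ]′

-- A fixed point `i` would give `n = 2i + 1`. This supplies the perfect matching when there are no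
-- colours.
opposite-pairing : ∀ {n} → 2 ∣ n → IsPairing (opposite {n})
opposite-pairing {n} (divides q n≡) = record
  { involutive = opposite-involutive
  ; fixedPointFree = λ i p → even≢odd q (toℕ i) (begin
      2 * q                        ≡⟨ trans (*-comm 2 q) (sym n≡) ⟩
      n                            ≡⟨ sym (m∸n+n≡m (toℕ<n i)) ⟩
      n ∸ suc (toℕ i) + suc (toℕ i) ≡⟨ cong (_+ suc (toℕ i)) (trans (sym (opposite-prop i)) (cong toℕ p)) ⟩
      toℕ i + suc (toℕ i)          ≡⟨ +-suc (toℕ i) (toℕ i) ⟩
      suc (toℕ i + toℕ i)          ≡⟨ cong (λ a → suc (toℕ i + a)) (sym (+-identityʳ (toℕ i))) ⟩
      suc (2 * toℕ i)              ∎) }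
  where open ≡-Reasoning

-- Schedule of the gadgets and final assembly.

rounds : ∀ {k} → ℕ → List (Fin k)
rounds zero        = []
rounds {k} (suc r) = allFin k ++ rounds r

length-rounds : ∀ {k} r → length (rounds {k} r) ≡ r * k
length-rounds zero = refl
length-rounds {k} (suc r) =
  trans (length-++ (allFin k)) (cong₂ _+_ (length-tabulate (id {A = Fin k})) (length-rounds r))

count-rounds : ∀ {k} (l : Fin k) r → r ≤ length (filter (_≟ l) (rounds r))
count-rounds l zero = z≤n
count-rounds {k} l (suc r) = ≤-trans
  (+-mono-≤ (nonempty (∈-filter⁺ (_≟ l) (∈-allFin l) refl)) (count-rounds l r))
  (≤-reflexive (sym (trans (cong length (filter-++ (_≟ l) (allFin k) (rounds r)))
                           (length-++ (filter (_≟ l) (allFin k))))))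
  where
  nonempty : ∀ {x : Fin k} {xs} → x ∈ xs → 1 ≤ length xs
  nonempty (here _)  = s≤s z≤n
  nonempty (there _) = s≤s z≤n

-- k gadgets for each of the k colours; the 3 provides three distinct vertices.
bound : ℕ → ℕ
bound k = 3 + k * k * gadgetCost k

module _ {k n : ℕ} (l₀ : Fin k) (M : Fin k → EdgeSet n) (pM : ∀ i → IsPerfectMatching (M i))
         (private-edges : ∀ i → bound k ≤ ∣ M i ∖ ⋃≢ i M ∣) where

  private
    m : Fin k → Fin n → Fin n
    m i = mate (pM i)

    m-pairing : ∀ i → IsPairing (m i)
    m-pairing i = mate-pairing (pM i)

    -- Turns the count of private edges into a choice: fewer than `bound k` forbidden vertices
    -- cannot meet all the private edges of `M j`.
    fresh : ∀ j T′ → length T′ < bound k →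
            ∃[ w ] (w ∉ T′ × m j w ∉ T′ × (∀ l → l ≢ j → m l w ≢ m j w))
    fresh j T′ T′<C with edge-avoiding (M j ∖ ⋃≢ j M) T′
        (λ {u} {v} {w} p q → IsPerfectMatching.disjoint (pM j) u v w (proj₁ (to T-∧ p)) (proj₁ (to T-∧ q)))
        (≤-trans T′<C (private-edges j))
    ... | u , v , u∉ , v∉ , uv with to (∈⇔mate (pM j) u v) (proj₁ (to T-∧ uv))
    ...   | refl = u , u∉ , v∉ , λ l l≢j q →
      T-not (adj (⋃≢ j M) u v) (proj₂ (to (T-∧ {adj (M j) u v}) uv))
        (∈-⋃≢ {M = M} l≢j (from (∈⇔mate (pM l) u v) q))

    open Completion m m-pairing
    open Gadgets (bound k) fresh

    2<C : 2 < bound k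
    2<C = s≤s (s≤s (s≤s z≤n))

    completed : Completed empty (λ l → k ∸ count l (rounds k))
    completed = complete l₀ (rounds k) empty [] (λ _ → refl , λ _ → refl)
      (s≤s (≤-trans (≤-reflexive (trans (+-identityʳ _) (cong (_* gadgetCost k) (length-rounds k))))
                    (m≤n+m _ 2)))

  common-completion : ∃[ M* ] (IsPerfectMatching M* × (∀ i → IsHamiltonCycle (M* ∪ M i)))
  common-completion =
    -- Each colour occurs at least `k` times in `rounds k`, which uses up the bound `k` left by
    -- `greedy`.
    let t , pt , connected = all-connected completed (λ l → m≤n⇒m∸n≡0 (count-rounds l k))
    in edges pt , edges-perfect pt , λ i → hamiltonian (3≤n l₀ 2<C) pt (pM i) (vertex l₀ 2<C) (connected i (vertex l₀ 2<C))

theorem1p3 : ∀ (k : ℕ) → ∃[ C ] ∀ (n : ℕ) → 2 ∣ n →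
    ∀ (M : Fin k → EdgeSet n) → (∀ i → IsPerfectMatching (M i)) →
    (∀ i → C ≤ ∣ M i ∖ ⋃≢ i M ∣) →
    ∃[ M* ] (IsPerfectMatching M* × (∀ i → IsHamiltonCycle (M* ∪ M i)))
theorem1p3 zero = 0 , λ n 2∣n M _ _ →
  edges (opposite-pairing 2∣n) , edges-perfect (opposite-pairing 2∣n) , λ ()
theorem1p3 (suc k) = bound (suc k) , λ n _ M pM h → common-completion zero M pM h
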